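{- Every graph $G=(V,E)$ with minimum degree $\delta\geq 10^6$ can be decomposed into two $\{1,2\}$-weight colourable subgraphs; that is, there is a partition $E=E_1\cup E_2$ such that for each $i\in\{1,2\}$ the graph $G_i=(V,E_i)$ admits a function $c_i:E_i\to\{1,2\}$ with $\sum_{w: uw\in E_i}c_i(uw)\neq \sum_{w: vw\in E_i}c_i(vw)$ for every edge $uv\in E_i$.
   Context: For a graph $F$ and an edge weighting $c:E(F)\to\{1,2\}$, the weighted degree of a vertex $v$ is $d_c(v)=\sum_{u\in N_F(v)}c(uv)$. A graph $F$ is $\{1,2\}$-weight colourable if there exists $c:E(F)\to\{1,2\}$ such that $d_c(u)\neq d_c(v)$ for every edge $uv\in E(F)$. A decomposition of a graph into two subgraphs means a partition of its edge set into two parts. -}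

module Defs where

open import Data.Nat using (ℕ; _≤_)
open import Data.Fin using (Fin)
open import Data.Bool using (Bool; true; false; if_then_else_; _∧_; not)
open import Data.List using (List; map; allFin)
open import Data.Nat.ListAction using (sum)
open import Data.Product using (Σ; _×_)
open import Data.Sum using (_⊎_)
open import Relation.Binary.PropositionalEquality using (_≡_; _≢_; refl; cong; cong₂)

record Graph (n : ℕ) : Set where
  field
    adj   : Fin n → Fin n → Bool
    sym   : ∀ u v → adj u v ≡ adj v u
    irref : ∀ v → adj v v ≡ false
open Graph public

degree : ∀ {n} → Graph n → Fin n → ℕ
degree {n} G v = sum (map (λ w → if adj G v w then 1 else 0) (allFin n))

minDegree≥ : ∀ {n} → Graph n → ℕ → Set
minDegree≥ G d = ∀ v → d ≤ degree G v

restrict : ∀ {n} (G : Graph n) (m : Fin n → Fin n → Bool) →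
           (∀ u v → m u v ≡ m v u) → Graph n
restrict G m msym = record
  { adj   = λ u v → adj G u v ∧ m u v
  ; sym   = λ u v → lemma u v
  ; irref = λ v → irr v
  }
  where
    lemma : ∀ u v → (adj G u v ∧ m u v) ≡ (adj G v u ∧ m v u)
    lemma u v = cong₂ _∧_ (Graph.sym G u v) (msym u v)
    irr : ∀ v → (adj G v v ∧ m v v) ≡ false
    irr v rewrite Graph.irref G v = refl

notMask : ∀ {n} → (Fin n → Fin n → Bool) → (Fin n → Fin n → Bool)
notMask m u v = not (m u v)

notMask-sym : ∀ {n} (m : Fin n → Fin n → Bool) → (∀ u v → m u v ≡ m v u) →
              ∀ u v → notMask m u v ≡ notMask m v u
notMask-sym m msym u v = cong not (msym u v)

-- An edge weighting c : E(F) → {1,2}, represented as a symmetric function on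
-- pairs whose value on every edge of F is 1 or 2 (values on non-edges are
-- irrelevant since they never enter a weighted degree).
record Weighting12 {n : ℕ} (F : Graph n) : Set where
  field
    c     : Fin n → Fin n → ℕ
    c-sym : ∀ u v → c u v ≡ c v u
    c-12  : ∀ u v → adj F u v ≡ true → (c u v ≡ 1) ⊎ (c u v ≡ 2)
open Weighting12 public

wdeg : ∀ {n} {F : Graph n} → Weighting12 F → Fin n → ℕ
wdeg {n} {F} w v = sum (map (λ u → if adj F v u then c w v u else 0) (allFin n))

WeightColourable12 : ∀ {n} → Graph n → Set
WeightColourable12 {n} F =
  Σ (Weighting12 F) λ w → ∀ u v → adj F u v ≡ true → wdeg w u ≢ wdeg w v

{-# OPTIONS --safe #-}
module Submission where

open import Defs
open import Data.Nat using (ℕ; zero; suc; _+_; _*_; _^_; _≤_; _<_; _≤?_; _<?_; _<ᵇ_; s≤s; s≤s⁻¹; z≤n; ⌊_/2⌋; NonZero; >-nonZero)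
open import Data.Nat.Properties hiding (_≟_; suc-injective)
import Data.Nat.Properties as ℕ
open import Data.Nat.DivMod using (_%_; [m+kn]%n≡m%n; m<n⇒m%n≡m)
open import Data.Nat.Induction using (<-wellFounded)
open import Data.Nat.Solver using (module +-*-Solver)
open +-*-Solver using (solve; _:=_; _:+_; _:*_; con)
import Data.Nat.ListAction as List
open import Data.Fin as Fin using (Fin; zero; suc; toℕ; fromℕ<; combine; punchIn; _≟_)
import Data.Fin.Properties as Fin
open import Data.Bool using (Bool; true; false; if_then_else_; _∧_; _∨_; not)
open import Data.Bool.Properties using (not-¬; ¬-not; not-injective; ∨-comm; ∧-conicalˡ)
open import Data.List using (List; []; _∷_; map; length; lookup; tabulate; allFin; cartesianProduct)
open import Data.List.Properties using (map-∘; length-map; map-tabulate)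
open import Data.List.Membership.Propositional using (_∈_; _∉_)
open import Data.List.Membership.Propositional.Properties using (∈-map⁺; ∈-cartesianProduct⁺; ∈-allFin)
open import Data.List.Membership.DecPropositional using () renaming (_∈?_ to member?)
open import Data.List.Relation.Unary.All as All using ([]; _∷_)
import Data.List.Relation.Unary.All.Properties as All
open import Data.List.Relation.Unary.AllPairs using ([]; _∷_)
open import Data.List.Relation.Unary.Any using (here; there; index)
open import Data.List.Relation.Unary.Any.Properties using (lookup-index)
open import Data.List.Relation.Unary.Unique.Propositional using (Unique)
import Data.List.Relation.Unary.Unique.Propositional.Properties as Unique
open import Data.Maybe as Maybe using (Maybe; just; nothing; maybe′; _>>=_)
open import Data.Maybe.Properties as Maybe using (just-injective)
open import Data.Product using (Σ; _×_; _,_; ∃; ∃₂; proj₁; proj₂; swap)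
open import Data.Product.Properties using (≡-dec)
open import Data.Sum using (_⊎_; inj₁; inj₂)
open import Data.Unit using (⊤; tt)
open import Data.Vec.Functional using (updateAt)
open import Data.Vec.Functional.Properties using (updateAt-updates; updateAt-minimal)
open import Function using (_∘_; const; case_of_)
open import Induction.WellFounded using (Acc; acc)
open import Relation.Nullary using (¬?; does; yes; no; contradiction)
open import Relation.Nullary.Decidable using (dec-true; dec-false; decidable-stable)
open import Relation.Binary.Definitions using (DecidableEquality; Tri; tri<; tri≈; tri>)
open import Relation.Binary.PropositionalEquality using (_≡_; _≢_; refl; trans; cong; cong₂; subst; subst₂; module ≡-Reasoning) renaming (sym to ≡-sym)
open import Algebra.Properties.Semiring.Sum +-*-semiring using (sum; sum-cong-≗; ∑-distrib-+; ∑-comm; sum-remove; *-distribˡ-sum)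

-- Choose vertex types φ₁, φ₂ with 100 values each by weighted maximum cuts, so that every vertex v of
-- degree d has few neighbours sharing one of its types and O(d / 100²) sharing both. Edges inside a
-- φ₂-class go to G₁, those inside a φ₁-class only go to G₂, and all others are split between G₁ and
-- G₂ so that each vertex owns a constant fraction of its edges in both. In G₁ and G₂ all edges get
-- weight 1, and the owner of an edge may raise it to 2. Marking half of the owned edges as free and
-- the others as forced, alternately in pairs both along the edges owned by a vertex and, in
-- processing order, along the owners of the edges received by a vertex, the forced ones can keep the
-- extra weight received by each vertex within a window of three values, whatever is done with the
-- free ones. Processing the vertices in order, the free edges of v then let us put the window of v in
-- the residue class modulo 3 · 100 belonging to its type, away from the windows of the few earlier
-- neighbours of the same type. Balanced orientations and alternating marks both come from
-- 2-colouring the union of two matchings, which has only even cycles.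

-- Finite sums and indicators.

⟦_⟧ : Bool → ℕ
⟦ b ⟧ = if b then 1 else 0

sum-allFin : ∀ {n} (f : Fin n → ℕ) → List.sum (map f (allFin n)) ≡ sum f
sum-allFin {n} f = trans (cong List.sum (map-tabulate (λ i → i) f)) (go f)
  where
  go : ∀ {k} (g : Fin k → ℕ) → List.sum (tabulate g) ≡ sum g
  go {zero}  g = refl
  go {suc k} g = cong (g zero +_) (go (g ∘ suc))

sum-mono-≤ : ∀ {n} {f g : Fin n → ℕ} → (∀ i → f i ≤ g i) → sum f ≤ sum g
sum-mono-≤ {zero}  f≤g = z≤n
sum-mono-≤ {suc n} f≤g = +-mono-≤ (f≤g zero) (sum-mono-≤ (f≤g ∘ suc))

sum-zero : ∀ {n} (f : Fin n → ℕ) → (∀ i → f i ≡ 0) → sum f ≡ 0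
sum-zero {zero}  f f≡0 = refl
sum-zero {suc n} f f≡0 = cong₂ _+_ (f≡0 zero) (sum-zero (f ∘ suc) (f≡0 ∘ suc))

sum-const : ∀ n k → sum {n} (λ _ → k) ≡ n * k
sum-const zero    k = refl
sum-const (suc n) k = cong (k +_) (sum-const n k)

sum-≟ : ∀ {n} (i : Fin n) → sum (λ j → ⟦ does (i ≟ j) ⟧) ≡ 1
sum-≟ {suc n} zero = cong suc (sum-zero {n} (λ _ → 0) (λ _ → refl))
sum-≟ (suc i) = sum-≟ i

-- Weighted maximum cuts by local search.

sameType : ∀ {n p} → (Fin n → Fin p) → Fin n → Fin n → Bool
sameType φ u v = does (φ u ≟ φ v)

sameType-refl : ∀ {n p} (φ : Fin n → Fin p) {u v} → φ u ≡ φ v → sameType φ u v ≡ true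
sameType-refl φ {u} {v} eq = dec-true (φ u ≟ φ v) eq

sameType-sym : ∀ {n p} (φ : Fin n → Fin p) u v → sameType φ u v ≡ sameType φ v u
sameType-sym φ u v with φ u ≟ φ v | φ v ≟ φ u
... | yes _ | yes _ = refl
... | no  _ | no  _ = refl
... | yes e | no ¬e = contradiction (≡-sym e) ¬e
... | no ¬e | yes e = contradiction (≡-sym e) ¬e

module MaxCut {n p : ℕ} (w : Fin n → Fin n → ℕ) where

  cost : (Fin n → Fin p) → Fin n → Fin p → ℕ
  cost φ v t = sum λ u → w v u * ⟦ does (φ u ≟ t) ⟧

  total : (Fin n → Fin p) → ℕ
  total φ = sum λ v → cost φ v (φ v)

  -- Averaging: every `u` has exactly one type, so the costs of the `p` possible types of `v` add up
  -- to `sum (w v)`, and the least of them is at most the average.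
  locallyOptimal⇒ : ∀ φ → (∀ v t → cost φ v (φ v) ≤ cost φ v t) →
                    ∀ v → p * cost φ v (φ v) ≤ sum (w v)
  locallyOptimal⇒ φ opt v = begin
    p * cost φ v (φ v)                                  ≡⟨ sum-const p _ ⟨
    sum {p} (λ _ → cost φ v (φ v))                      ≤⟨ sum-mono-≤ (opt v) ⟩
    sum {p} (cost φ v)                                  ≡⟨ ∑-comm (λ t u → w v u * ⟦ does (φ u ≟ t) ⟧) ⟩
    sum (λ u → sum (λ t → w v u * ⟦ does (φ u ≟ t) ⟧))  ≡⟨ sum-cong-≗ (λ u → *-distribˡ-sum (w v u) (λ t → ⟦ does (φ u ≟ t) ⟧)) ⟨
    sum (λ u → w v u * sum (λ t → ⟦ does (φ u ≟ t) ⟧))  ≡⟨ sum-cong-≗ (λ u → cong (w v u *_) (sum-≟ (φ u))) ⟩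
    sum (λ u → w v u * 1)                               ≡⟨ sum-cong-≗ (λ u → *-identityʳ (w v u)) ⟩
    sum (w v)                                           ∎
    where open ≤-Reasoning

-- By symmetry row and column `v` have the same sum, and they meet only in a zero. Changing the type
-- of `v` leaves the last summand alone.
sum-isolate : ∀ {n} (g : Fin (suc n) → Fin (suc n) → ℕ) →
              (∀ u v → g u v ≡ g v u) → (∀ v → g v v ≡ 0) → ∀ v →
              sum (λ u → sum (g u)) ≡
              sum (g v) + (sum (g v) + sum (λ u → sum (λ x → g (punchIn v u) (punchIn v x))))
sum-isolate g g-sym g-irr v = begin
  sum (λ u → sum (g u))
    ≡⟨ sum-remove {i = v} (λ u → sum (g u)) ⟩
  sum (g v) + sum (λ u → sum (g (punchIn v u)))
    ≡⟨ cong (sum (g v) +_) (sum-cong-≗ (λ u → sum-remove {i = v} (g (punchIn v u)))) ⟩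
  sum (g v) + sum (λ u → g (punchIn v u) v + rest u)
    ≡⟨ cong (sum (g v) +_) (∑-distrib-+ (λ u → g (punchIn v u) v) rest) ⟩
  sum (g v) + (sum (λ u → g (punchIn v u) v) + sum rest)
    ≡⟨ cong (λ z → sum (g v) + (z + sum rest)) column ⟩
  sum (g v) + (sum (g v) + sum rest) ∎
  where
  open ≡-Reasoning
  rest : _ → ℕ
  rest u = sum (λ x → g (punchIn v u) (punchIn v x))
  column : sum (λ u → g (punchIn v u) v) ≡ sum (g v)
  column = begin
    sum (λ u → g (punchIn v u) v)         ≡⟨ sum-cong-≗ (λ u → g-sym (punchIn v u) v) ⟩
    sum (λ u → g v (punchIn v u))         ≡⟨ cong (_+ sum (λ u → g v (punchIn v u))) (g-irr v) ⟨
    g v v + sum (λ u → g v (punchIn v u)) ≡⟨ sum-remove {i = v} (g v) ⟨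
    sum (g v)                             ∎

-- Moving a vertex to a cheaper type strictly lowers the weight inside the classes, so local search
-- from `φ₀` stops at an assignment that no single move improves.
maxCut : ∀ {n} p (w : Fin n → Fin n → ℕ) → (∀ u v → w u v ≡ w v u) → (∀ v → w v v ≡ 0) →
         (Fin n → Fin p) →
         ∃ λ (φ : Fin n → Fin p) → ∀ v → p * sum (λ u → w v u * ⟦ sameType φ u v ⟧) ≤ sum (w v)
maxCut {zero}  p w w-sym w-irr φ₀ = φ₀ , λ ()
maxCut {suc n} p w w-sym w-irr φ₀ = search φ₀ (<-wellFounded (total φ₀))
  where
  open MaxCut {suc n} {p} w

  g : (Fin (suc n) → Fin p) → Fin (suc n) → Fin (suc n) → ℕ
  g φ v u = w v u * ⟦ sameType φ u v ⟧

  total-isolate : ∀ φ v → total φ ≡ cost φ v (φ v) + (cost φ v (φ v) +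
                    sum (λ u → sum (λ x → g φ (punchIn v u) (punchIn v x))))
  total-isolate φ v = sum-isolate (g φ)
    (λ u x → cong₂ _*_ (w-sym u x) (cong ⟦_⟧ (sameType-sym φ x u))) (λ x → cong (_* _) (w-irr x)) v

  move-decreases : ∀ φ v t → cost φ v t < cost φ v (φ v) → total (updateAt φ v (const t)) < total φ
  move-decreases φ v t lt = begin-strict
    total φ′
      ≡⟨ total-isolate φ′ v ⟩
    cost φ′ v (φ′ v) + (cost φ′ v (φ′ v) + sum (λ u → sum (λ x → g φ′ (punchIn v u) (punchIn v x))))
      ≡⟨ cong₂ (λ a b → a + (a + b)) costs (sum-cong-≗ (λ u → sum-cong-≗ (λ x →
           cong₂ (λ a b → w (punchIn v u) (punchIn v x) * ⟦ does (a ≟ b) ⟧) (away x) (away u)))) ⟩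
    cost φ v t + (cost φ v t + sum (λ u → sum (λ x → g φ (punchIn v u) (punchIn v x))))
      <⟨ +-mono-<-≤ lt (+-monoˡ-≤ _ (<⇒≤ lt)) ⟩
    cost φ v (φ v) + (cost φ v (φ v) + sum (λ u → sum (λ x → g φ (punchIn v u) (punchIn v x))))
      ≡⟨ total-isolate φ v ⟨
    total φ ∎
    where
    open ≤-Reasoning
    φ′ = updateAt φ v (const t)
    away : ∀ u → φ′ (punchIn v u) ≡ φ (punchIn v u)
    away u = updateAt-minimal (punchIn v u) v φ (Fin.punchInᵢ≢i v u)
    term : ∀ u → w v u * ⟦ does (φ′ u ≟ φ′ v) ⟧ ≡ w v u * ⟦ does (φ u ≟ t) ⟧
    term u with u ≟ v
    ... | yes refl = trans (cong (_* _) (w-irr v)) (≡-sym (cong (_* _) (w-irr v)))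
    ... | no u≢v   = cong₂ (λ a b → w v u * ⟦ does (a ≟ b) ⟧)
                           (updateAt-minimal u v φ u≢v) (updateAt-updates v φ)
    costs : cost φ′ v (φ′ v) ≡ cost φ v t
    costs = sum-cong-≗ term

  search : ∀ φ → Acc _<_ (total φ) →
           ∃ λ (φ : Fin (suc n) → Fin p) → ∀ v → p * cost φ v (φ v) ≤ sum (w v)
  search φ (acc rec) with Fin.any? (λ v → Fin.any? (λ t → cost φ v t <? cost φ v (φ v)))
  ... | yes (v , t , lt) = search (updateAt φ v (const t)) (rec (move-decreases φ v t lt))
  ... | no none = φ , locallyOptimal⇒ φ (λ v t → ≮⇒≥ (λ lt → none (v , t , lt)))

-- Proper 2-colourings of the union of two matchings

-- A matching as a partial involution without fixed points; `nothing` marks the unmatched elements.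
record Matching (H : Set) : Set where
  field
    partner       : H → Maybe H
    partner-sym   : ∀ {x y} → partner x ≡ just y → partner y ≡ just x
    partner-irref : ∀ {x} → partner x ≢ just x
open Matching

Proper : ∀ {H} → Matching H → (H → Bool) → Set
Proper M σ = ∀ {x y} → partner M x ≡ just y → σ x ≢ σ y

module _ {H : Set} (_≟ᴴ_ : DecidableEquality H) where

  -- Deletes h and t from M and matches their former partners with each other.
  splice : (M : Matching H) {h t : H} → h ≢ t → partner M h ≢ just t → Matching H
  splice M {h} {t} h≢t ρh≢t = record
    { partner = ρ′ ; partner-sym = ρ′-sym _ _ ; partner-irref = ρ′-irref _ }
    where
    ρ = partner M

    bypass : H → Maybe H
    bypass y with y ≟ᴴ h | y ≟ᴴ t
    ... | yes _ | _     = ρ t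
    ... | no  _ | yes _ = ρ h
    ... | no  _ | no  _ = just y

    ρ′ : H → Maybe H
    ρ′ x with x ≟ᴴ h | x ≟ᴴ t
    ... | yes _ | _     = nothing
    ... | no  _ | yes _ = nothing
    ... | no  _ | no  _ = ρ x >>= bypass

    ρ′-off : ∀ {x} → x ≢ h → x ≢ t → ρ′ x ≡ (ρ x >>= bypass)
    ρ′-off {x} x≢h x≢t with x ≟ᴴ h | x ≟ᴴ t
    ... | yes x≡h | _       = contradiction x≡h x≢h
    ... | no  _   | yes x≡t = contradiction x≡t x≢t
    ... | no  _   | no  _   = refl

    bypass-h : bypass h ≡ ρ t
    bypass-h with h ≟ᴴ h | h ≟ᴴ t
    ... | yes _  | _ = refl
    ... | no h≢h | _ = contradiction refl h≢h

    bypass-t : bypass t ≡ ρ h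
    bypass-t with t ≟ᴴ h | t ≟ᴴ t
    ... | yes t≡h | _       = contradiction (≡-sym t≡h) h≢t
    ... | no  _   | yes _   = refl
    ... | no  _   | no  t≢t = contradiction refl t≢t

    bypass-off : ∀ {y} → y ≢ h → y ≢ t → bypass y ≡ just y
    bypass-off {y} y≢h y≢t with y ≟ᴴ h | y ≟ᴴ t
    ... | yes y≡h | _       = contradiction y≡h y≢h
    ... | no  _   | yes y≡t = contradiction y≡t y≢t
    ... | no  _   | no  _   = refl

    data View (x z : H) : Set where
      via-h  : ρ x ≡ just h → ρ t ≡ just z → View x z
      via-t  : ρ x ≡ just t → ρ h ≡ just z → View x z
      direct : ρ x ≡ just z → z ≢ h → z ≢ t → View x z

    view : ∀ x z → ρ′ x ≡ just z → (x ≢ h × x ≢ t) × View x z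
    view x z eq with x ≟ᴴ h | x ≟ᴴ t
    view x z () | yes _ | _
    view x z () | no _  | yes _
    view x z eq | no x≢h | no x≢t with ρ x in ρx
    view x z () | no x≢h | no x≢t | nothing
    ... | just y with y ≟ᴴ h | y ≟ᴴ t
    ...   | yes refl | _        = (x≢h , x≢t) , via-h ρx eq
    ...   | no _     | yes refl = (x≢h , x≢t) , via-t ρx eq
    ...   | no y≢h   | no y≢t   with refl ← just-injective eq = (x≢h , x≢t) , direct ρx y≢h y≢t

    ρt≢h : ρ t ≢ just h
    ρt≢h eq = ρh≢t (partner-sym M eq)

    ρ′-sym : ∀ x z → ρ′ x ≡ just z → ρ′ z ≡ just x
    ρ′-sym x z eq with view x z eq
    ... | (x≢h , x≢t) , via-h ρx ρt =
      trans (ρ′-off (λ { refl → ρt≢h ρt }) (λ { refl → partner-irref M ρt }))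
      (trans (cong (_>>= bypass) (partner-sym M ρt)) (trans bypass-t (partner-sym M ρx)))
    ... | (x≢h , x≢t) , via-t ρx ρh =
      trans (ρ′-off (λ { refl → partner-irref M ρh }) (λ { refl → ρh≢t ρh }))
      (trans (cong (_>>= bypass) (partner-sym M ρh)) (trans bypass-h (partner-sym M ρx)))
    ... | (x≢h , x≢t) , direct ρx z≢h z≢t =
      trans (ρ′-off z≢h z≢t)
      (trans (cong (_>>= bypass) (partner-sym M ρx)) (bypass-off x≢h x≢t))

    ρ′-irref : ∀ x → ρ′ x ≢ just x
    ρ′-irref x eq with view x x eq
    ... | _ , via-h ρx ρt  = h≢t (just-injective (trans (≡-sym ρx) (partner-sym M ρt)))
    ... | _ , via-t ρx ρh  = h≢t (just-injective (trans (≡-sym (partner-sym M ρh)) ρx))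
    ... | _ , direct ρx _ _ = partner-irref M ρx

  splice-direct : (M : Matching H) {h t : H} (h≢t : h ≢ t) (ρh≢t : partner M h ≢ just t) →
    ∀ {x y} → x ≢ h → x ≢ t → y ≢ h → y ≢ t →
    partner M x ≡ just y → partner (splice M h≢t ρh≢t) x ≡ just y
  splice-direct M {h} {t} h≢t ρh≢t {x} {y} x≢h x≢t y≢h y≢t ρx with x ≟ᴴ h | x ≟ᴴ t
  ... | yes x≡h | _       = contradiction x≡h x≢h
  ... | no  _   | yes x≡t = contradiction x≡t x≢t
  ... | no  _   | no  _   rewrite ρx with y ≟ᴴ h | y ≟ᴴ t
  ...   | yes y≡h | _       = contradiction y≡h y≢h
  ...   | no  _   | yes y≡t = contradiction y≡t y≢t
  ...   | no  _   | no  _   = refl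

  splice-bridge : (M : Matching H) {h t : H} (h≢t : h ≢ t) (ρh≢t : partner M h ≢ just t) →
    ∀ {x y} → partner M h ≡ just x → partner M t ≡ just y →
    partner (splice M h≢t ρh≢t) x ≡ just y
  splice-bridge M {h} {t} h≢t ρh≢t {x} {y} ρh ρt with x ≟ᴴ h | x ≟ᴴ t
  ... | yes refl | _        = contradiction ρh (partner-irref M)
  ... | no  _    | yes refl = contradiction ρh ρh≢t
  ... | no  _    | no  _    rewrite partner-sym M ρh with h ≟ᴴ h | h ≟ᴴ t
  ...   | yes _  | _ = ρt
  ...   | no h≢h | _ = contradiction refl h≢h

  recolour : (H → Bool) → H → H → Bool → H → Bool
  recolour σ h t b x with x ≟ᴴ h | x ≟ᴴ t
  ... | yes _ | _     = b
  ... | no  _ | yes _ = not b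
  ... | no  _ | no  _ = σ x

  recolour-h : ∀ σ h t b → recolour σ h t b h ≡ b
  recolour-h σ h t b with h ≟ᴴ h | h ≟ᴴ t
  ... | yes _  | _ = refl
  ... | no h≢h | _ = contradiction refl h≢h

  recolour-t : ∀ σ {h t} b → h ≢ t → recolour σ h t b t ≡ not b
  recolour-t σ {h} {t} b h≢t with t ≟ᴴ h | t ≟ᴴ t
  ... | yes t≡h | _       = contradiction (≡-sym t≡h) h≢t
  ... | no  _   | yes _   = refl
  ... | no  _   | no  t≢t = contradiction refl t≢t

  recolour-off : ∀ σ {h t} b {x} → x ≢ h → x ≢ t → recolour σ h t b x ≡ σ x
  recolour-off σ {h} {t} b {x} x≢h x≢t with x ≟ᴴ h | x ≟ᴴ t
  ... | yes x≡h | _       = contradiction x≡h x≢h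
  ... | no  _   | yes x≡t = contradiction x≡t x≢t
  ... | no  _   | no  _   = refl

  -- If `h` and `t` both have partners in `M`, the splice matches these with each other, so their
  -- colours differ. Giving `h` and `t` the colours opposite to their partners then makes `h` and
  -- `t` differ too, which is what the deleted edge between them demands.
  unsplice : (M : Matching H) {h t : H} (h≢t : h ≢ t) (ρh≢t : partner M h ≢ just t) →
    ∀ σ → Proper (splice M h≢t ρh≢t) σ → ∃ λ b → Proper M (recolour σ h t b)
  unsplice M {h} {t} h≢t ρh≢t σ σ-proper = b , proper
    where
    ρ = partner M
    σ′ : Bool → H → Bool
    σ′ = recolour σ h t

    choose : ∀ mx my → (∀ {x y} → mx ≡ just x → my ≡ just y → σ x ≢ σ y) →
             ∃ λ b → (∀ {x} → mx ≡ just x → b ≡ not (σ x)) × (∀ {y} → my ≡ just y → not b ≡ not (σ y))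
    -- Both unmatched: the colour is arbitrary.
    choose nothing  nothing  _    = true , (λ ()) , (λ ())
    choose nothing  (just y) _    = σ y , (λ ()) , λ { refl → refl }
    choose (just x) nothing  _    = not (σ x) , (λ { refl → refl }) , (λ ())
    choose (just x) (just y) diff = not (σ x) , (λ { refl → refl }) ,
      λ { refl → cong not (≡-sym (¬-not (diff refl refl ∘ ≡-sym))) }

    choice = choose (ρ h) (ρ t) (λ ρh ρt → σ-proper (splice-bridge M h≢t ρh≢t ρh ρt))

    b = proj₁ choice

    from-h : ∀ {y} → ρ h ≡ just y → σ′ b h ≢ σ′ b y
    from-h {y} ρh eq = not-¬ refl (begin
      σ y          ≡⟨ recolour-off σ b y≢h y≢t ⟨
      σ′ b y       ≡⟨ eq ⟨
      σ′ b h       ≡⟨ recolour-h σ h t b ⟩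
      b            ≡⟨ proj₁ (proj₂ choice) ρh ⟩
      not (σ y)    ∎)
      where
      open ≡-Reasoning
      y≢h : y ≢ h
      y≢h refl = partner-irref M ρh
      y≢t : y ≢ t
      y≢t refl = ρh≢t ρh

    from-t : ∀ {y} → ρ t ≡ just y → σ′ b t ≢ σ′ b y
    from-t {y} ρt eq = not-¬ refl (begin
      σ y          ≡⟨ recolour-off σ b y≢h y≢t ⟨
      σ′ b y       ≡⟨ eq ⟨
      σ′ b t       ≡⟨ recolour-t σ b h≢t ⟩
      not b        ≡⟨ proj₂ (proj₂ choice) ρt ⟩
      not (σ y)    ∎)
      where
      open ≡-Reasoning
      y≢h : y ≢ h
      y≢h refl = ρh≢t (partner-sym M ρt)
      y≢t : y ≢ t
      y≢t refl = partner-irref M ρt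

    classify : ∀ x → x ≡ h ⊎ x ≡ t ⊎ (x ≢ h × x ≢ t)
    classify x with x ≟ᴴ h | x ≟ᴴ t
    ... | yes x≡h | _       = inj₁ x≡h
    ... | no  _   | yes x≡t = inj₂ (inj₁ x≡t)
    ... | no  x≢h | no  x≢t = inj₂ (inj₂ (x≢h , x≢t))

    proper : Proper M (σ′ b)
    proper {x} {y} ρx with classify x | classify y
    ... | inj₁ refl        | _                = from-h ρx
    ... | inj₂ (inj₁ refl) | _                = from-t ρx
    ... | inj₂ (inj₂ _)    | inj₁ refl        = from-h (partner-sym M ρx) ∘ ≡-sym
    ... | inj₂ (inj₂ _)    | inj₂ (inj₁ refl) = from-t (partner-sym M ρx) ∘ ≡-sym
    ... | inj₂ (inj₂ (x≢h , x≢t)) | inj₂ (inj₂ (y≢h , y≢t)) = λ eq →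
      σ-proper (splice-direct M h≢t ρh≢t x≢h x≢t y≢h y≢t ρx)
        (trans (≡-sym (recolour-off σ b x≢h x≢t)) (trans eq (recolour-off σ b y≢h y≢t)))

  module _ (code : H → ℕ) (code-injective : ∀ {x y} → code x ≡ code y → x ≡ y) where

    -- The end with the smaller code becomes `true`; unmatched elements default to `true`.
    colour-one : (M : Matching H) → ∃ (Proper M)
    colour-one M = σ , proper
      where
      σ : H → Bool
      σ x = maybe′ (λ y → code x <ᵇ code y) true (partner M x)

      <ᵇ-asym : ∀ m k → m ≢ k → (m <ᵇ k) ≢ (k <ᵇ m)
      <ᵇ-asym zero    zero    m≢k = contradiction refl m≢k
      <ᵇ-asym zero    (suc k) m≢k = λ ()
      <ᵇ-asym (suc m) zero    m≢k = λ ()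
      <ᵇ-asym (suc m) (suc k) m≢k = <ᵇ-asym m k (m≢k ∘ cong suc)

      proper : Proper M σ
      proper {x} {y} ρx rewrite ρx | partner-sym M ρx = <ᵇ-asym (code x) (code y)
        (λ eq → partner-irref M (trans ρx (cong just (≡-sym (code-injective eq)))))

    ProperOn : Matching H → List H → (H → Bool) → Set
    ProperOn N L σ = ∀ {x y} → x ∈ L → partner N x ≡ just y → σ x ≢ σ y

    -- An N-edge h t is removed by splicing h and t out of M; these two are coloured last.
    colour-along : (N : Matching H) (L : List H) (M : Matching H) →
                   ∃ λ σ → Proper M σ × ProperOn N L σ
    colour-along N [] M with σ , proper ← colour-one M = σ , proper , λ ()
    colour-along N (h ∷ L) M = go (partner N h) refl
      where
      extend : ∀ {σ} → ProperOn N L σ → (∀ {t} → partner N h ≡ just t → σ h ≢ σ t) →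
               ProperOn N (h ∷ L) σ
      extend along at-h (here refl) νx = at-h νx
      extend along at-h (there x∈L) νx = along x∈L νx

      reuse : (∀ {σ} → Proper M σ → ProperOn N L σ → ∀ {t} → partner N h ≡ just t → σ h ≢ σ t) →
              ∃ λ σ → Proper M σ × ProperOn N (h ∷ L) σ
      reuse at-h with σ , proper , along ← colour-along N L M =
        σ , proper , extend along (at-h proper along)

      go : (m : Maybe H) → partner N h ≡ m → ∃ λ σ → Proper M σ × ProperOn N (h ∷ L) σ
      go nothing νh = reuse (λ _ _ νh′ → case trans (≡-sym νh) νh′ of λ ())
      -- The edge needs no splicing if one of its ends occurs in the tail, which then handles it, or
      -- if `M` contains it as well.
      go (just t) νh with member? _≟ᴴ_ h L | member? _≟ᴴ_ t L | Maybe.≡-dec _≟ᴴ_ (partner M h) (just t)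
      ... | yes h∈L | _       | _     = reuse (λ _ along → along h∈L)
      ... | no _    | yes t∈L | _     = reuse (λ { _ along νh′ → case trans (≡-sym νh) νh′ of
                                          λ { refl → along t∈L (partner-sym N νh) ∘ ≡-sym } })
      ... | no _    | no _    | yes ρh = reuse (λ { proper _ νh′ → case trans (≡-sym νh) νh′ of
                                          λ { refl → proper ρh } })
      ... | no h∉L  | no t∉L  | no ρh≢t = recolour σ h t b , proj₂ (unsplice M h≢t ρh≢t σ proper) , extend along′ at-h
        where
        h≢t : h ≢ t
        h≢t refl = partner-irref N νh
        IH = colour-along N L (splice M h≢t ρh≢t)
        σ = proj₁ IH
        proper = proj₁ (proj₂ IH)
        b = proj₁ (unsplice M h≢t ρh≢t σ proper)
        at-h : ∀ {y} → partner N h ≡ just y → recolour σ h t b h ≢ recolour σ h t b y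
        at-h νh′ with refl ← just-injective (trans (≡-sym νh) νh′) = λ eq →
          not-¬ refl (trans (≡-sym (recolour-h σ h t b)) (trans eq (recolour-t σ b h≢t)))
        along′ : ProperOn N L (recolour σ h t b)
        along′ {x} {y} x∈L νx eq = proj₂ (proj₂ IH) x∈L νx
          (trans (≡-sym (recolour-off σ b x≢h x≢t)) (trans eq (recolour-off σ b y≢h y≢t)))
          where
          x≢h : x ≢ h
          x≢h refl = h∉L x∈L
          x≢t : x ≢ t
          x≢t refl = t∉L x∈L
          -- The ends `h` and `t` are each other's `N`-partner and both lie outside `L`, so no
          -- `N`-edge from `L` reaches them.
          y≢h : y ≢ h
          y≢h refl = x≢t (just-injective (trans (≡-sym (partner-sym N νx)) νh))
          y≢t : y ≢ t
          y≢t refl = x≢h (just-injective (trans (≡-sym (partner-sym N νx)) (partner-sym N νh)))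

Cell : ℕ → Set
Cell n = Fin n × Fin n

-- Running along the list of all cells makes the colouring proper for `N` everywhere.
twoMatchings : ∀ {n} (M N : Matching (Cell n)) → ∃ λ σ → Proper M σ × Proper N σ
twoMatchings {n} M N =
  let σ , proper , along = colour-along (≡-dec _≟_ _≟_) code code-injective N cells M
  in σ , proper , λ {x} → along (∈-cartesianProduct⁺ (∈-allFin (proj₁ x)) (∈-allFin (proj₂ x)))
  where
  cells = cartesianProduct (allFin n) (allFin n)
  code : Cell n → ℕ
  code (i , j) = toℕ (combine i j)
  code-injective : ∀ {x y} → code x ≡ code y → x ≡ y
  code-injective {i , j} {k , l} eq with refl , refl ← Fin.combine-injective i j k l (Fin.toℕ-injective eq) = refl

-- Marks alternating in consecutive pairs

Alternating : List Bool → Set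
Alternating []          = ⊤
Alternating (_ ∷ [])    = ⊤
Alternating (a ∷ b ∷ l) = a ≢ b × Alternating l

select : ∀ {n} → (Fin n → Bool) → List (Fin n)
select {zero}  P = []
select {suc n} P = if P zero then zero ∷ map suc (select (P ∘ suc)) else map suc (select (P ∘ suc))

select-unique : ∀ {n} (P : Fin n → Bool) → Unique (select P)
select-unique {zero}  P = []
select-unique {suc n} P with P zero
... | false = Unique.map⁺ Fin.suc-injective (select-unique (P ∘ suc))
... | true  = All.map⁺ (All.universal (λ _ ()) _) ∷ Unique.map⁺ Fin.suc-injective (select-unique (P ∘ suc))

module _ {A : Set} (_≟ᴬ_ : DecidableEquality A) where

  -- Matches first with second, third with fourth, and so on, leaving a possible last element alone.
  -- On a list without repetitions, a proper 2-colouring of this matching is an alternating marking.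
  pairUp : List A → A → Maybe A
  pairUp (x ∷ y ∷ l) z with z ≟ᴬ x | z ≟ᴬ y
  ... | yes _ | _     = just y
  ... | no  _ | yes _ = just x
  ... | no  _ | no  _ = pairUp l z
  pairUp _ z = nothing

  pairUp-∈ : ∀ l {x y} → pairUp l x ≡ just y → x ∈ l
  pairUp-∈ (a ∷ b ∷ l) {x} eq with x ≟ᴬ a | x ≟ᴬ b
  ... | yes x≡a | _       = here x≡a
  ... | no  _   | yes x≡b = there (here x≡b)
  ... | no  _   | no  _   = there (there (pairUp-∈ l eq))

  pairUp-fst : ∀ a b l → pairUp (a ∷ b ∷ l) a ≡ just b
  pairUp-fst a b l with a ≟ᴬ a
  ... | yes _  = refl
  ... | no a≢a = contradiction refl a≢a

  pairUp-snd : ∀ {a b} l → a ≢ b → pairUp (a ∷ b ∷ l) b ≡ just a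
  pairUp-snd {a} {b} l a≢b with b ≟ᴬ a | b ≟ᴬ b
  ... | yes b≡a | _       = contradiction (≡-sym b≡a) a≢b
  ... | no  _   | yes _   = refl
  ... | no  _   | no  b≢b = contradiction refl b≢b

  pairUp-rest : ∀ {a b} l {x} → x ≢ a → x ≢ b → pairUp (a ∷ b ∷ l) x ≡ pairUp l x
  pairUp-rest {a} {b} l {x} x≢a x≢b with x ≟ᴬ a | x ≟ᴬ b
  ... | yes x≡a | _       = contradiction x≡a x≢a
  ... | no  _   | yes x≡b = contradiction x≡b x≢b
  ... | no  _   | no  _   = refl

  pairUp-sym : ∀ {l} → Unique l → ∀ {x y} → pairUp l x ≡ just y → pairUp l y ≡ just x
  pairUp-sym {a ∷ b ∷ l} ((a≢b ∷ a∉l) ∷ (b∉l ∷ l!)) {x} {y} eq with x ≟ᴬ a | x ≟ᴬ b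
  ... | yes refl | _        with refl ← just-injective eq = pairUp-snd l a≢b
  ... | no  _    | yes refl with refl ← just-injective eq = pairUp-fst a x l
  ... | no  _    | no  _    =
    trans (pairUp-rest l (λ { refl → All.lookup a∉l y∈l refl }) (λ { refl → All.lookup b∉l y∈l refl }))
          (pairUp-sym l! eq)
    where y∈l = pairUp-∈ l (pairUp-sym l! eq)

  pairUp-irref : ∀ {l} → Unique l → ∀ {x} → pairUp l x ≢ just x
  pairUp-irref {a ∷ b ∷ l} ((a≢b ∷ _) ∷ (_ ∷ l!)) {x} eq with x ≟ᴬ a | x ≟ᴬ b
  ... | yes refl | _        = a≢b (≡-sym (just-injective eq))
  ... | no  _    | yes refl = a≢b (just-injective eq)
  ... | no  _    | no  _    = pairUp-irref l! eq

  pairUp-alternating : ∀ {l} → Unique l → (σ : A → Bool) →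
    (∀ {x y} → pairUp l x ≡ just y → σ x ≢ σ y) → Alternating (map σ l)
  pairUp-alternating {[]}        _ σ _ = tt
  pairUp-alternating {_ ∷ []}    _ σ _ = tt
  pairUp-alternating {a ∷ b ∷ l} ((_ ∷ a∉l) ∷ (b∉l ∷ l!)) σ proper =
    proper (pairUp-fst a b l) ,
    pairUp-alternating l! σ (λ {x} eq → let x∈l = pairUp-∈ l eq in proper (trans
      (pairUp-rest l (λ { refl → All.lookup a∉l x∈l refl }) (λ { refl → All.lookup b∉l x∈l refl })) eq))

-- Matchings on the cells of a square array.

linePairing : ∀ {n} → (Fin n → Bool) → Matching (Fin n)
linePairing P = record
  { partner       = pairUp _≟_ (select P)
  ; partner-sym   = pairUp-sym _≟_ (select-unique P)
  ; partner-irref = pairUp-irref _≟_ (select-unique P)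
  }

linePairing-alternating : ∀ {n} (P σ : Fin n → Bool) → Proper (linePairing P) σ → Alternating (map σ (select P))
linePairing-alternating P σ = pairUp-alternating _≟_ (select-unique P) σ

module _ {n : ℕ} where

  rowMatching : (Fin n → Matching (Fin n)) → Matching (Cell n)
  rowMatching M = record
    { partner       = ρ
    ; partner-sym   = λ {x} → ρ-sym x
    ; partner-irref = λ {x} → ρ-irref x
    }
    where
    ρ : Cell n → Maybe (Cell n)
    ρ (v , x) = Maybe.map (v ,_) (partner (M v) x)
    ρ-sym : ∀ c {c′} → ρ c ≡ just c′ → ρ c′ ≡ just c
    ρ-sym (v , x) eq with partner (M v) x in μx
    ρ-sym (v , x) refl | just y rewrite partner-sym (M v) μx = refl
    ρ-irref : ∀ c → ρ c ≢ just c
    ρ-irref (v , x) eq with partner (M v) x in μx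
    ρ-irref (v , x) refl | just .x = partner-irref (M v) μx

  transpose : Matching (Cell n) → Matching (Cell n)
  transpose M = record
    { partner       = λ c → Maybe.map swap (partner M (swap c))
    ; partner-sym   = λ {c} → ρ-sym c
    ; partner-irref = λ {c} → ρ-irref c
    }
    where
    ρ-sym : ∀ c {c′} → Maybe.map swap (partner M (swap c)) ≡ just c′ → Maybe.map swap (partner M (swap c′)) ≡ just c
    ρ-sym c eq with partner M (swap c) in μ
    ρ-sym c refl | just d rewrite partner-sym M μ = refl
    ρ-irref : ∀ c → Maybe.map swap (partner M (swap c)) ≢ just c
    ρ-irref c eq with partner M (swap c) in μ
    ρ-irref c refl | just d = partner-irref M μ

  -- A proper 2-colouring of this matching is an orientation: exactly one of `(u , v)` and `(v , u)`
  -- is `true` when `u` and `v` differ.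
  swapMatching : Matching (Cell n)
  swapMatching = record { partner = ρ ; partner-sym = λ {c} → ρ-sym c ; partner-irref = λ {c} → ρ-irref c }
    where
    ρ : Cell n → Maybe (Cell n)
    ρ (u , v) with u ≟ v
    ... | yes _ = nothing
    ... | no  _ = just (v , u)
    ρ-sym : ∀ c {c′} → ρ c ≡ just c′ → ρ c′ ≡ just c
    ρ-sym (u , v) eq with u ≟ v
    ρ-sym (u , v) refl | no u≢v with v ≟ u
    ... | yes v≡u = contradiction (≡-sym v≡u) u≢v
    ... | no  _   = refl
    ρ-irref : ∀ c → ρ c ≢ just c
    ρ-irref (u , v) eq with u ≟ v
    ρ-irref (u , v) refl | no u≢v = u≢v refl

  swapMatching-partner : ∀ {u v} → u ≢ v → partner swapMatching (u , v) ≡ just (v , u)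
  swapMatching-partner {u} {v} u≢v with u ≟ v
  ... | yes u≡v = contradiction u≡v u≢v
  ... | no  _   = refl

  rowMatching-alternating : ∀ (A σ : Fin n → Fin n → Bool) →
    Proper (rowMatching (linePairing ∘ A)) (λ (v , x) → σ v x) → ∀ v → Alternating (map (σ v) (select (A v)))
  rowMatching-alternating A σ proper v = linePairing-alternating (A v) (σ v)
    (λ eq → proper (cong (Maybe.map (v ,_)) eq))

  -- Pairs within rows form one matching of the cells and pairs within columns another; a common
  -- proper 2-colouring serves both.
  alternateRowsAndColumns : (A : Fin n → Fin n → Bool) → ∃ λ (σ : Fin n → Fin n → Bool) →
    (∀ v → Alternating (map (σ v) (select (A v)))) ×
    (∀ x → Alternating (map (λ v → σ v x) (select (λ v → A v x))))
  alternateRowsAndColumns A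
    with σ , rows , columns ← twoMatchings (rowMatching (linePairing ∘ A))
                                (transpose (rowMatching (λ x → linePairing (λ v → A v x)))) =
    (λ v x → σ (v , x)) , rowMatching-alternating A (λ v x → σ (v , x)) rows ,
    rowMatching-alternating (λ x v → A v x) (λ x v → σ (v , x)) (λ eq → columns (cong (Maybe.map swap) eq))

  -- The balanced orientation: the colour `true` at `(u , v)` lets `u` own the edge, and alternation
  -- along the rows gives each vertex about half of its edges.
  alternateRowsAntisymmetrically : (A : Fin n → Fin n → Bool) → ∃ λ (σ : Fin n → Fin n → Bool) →
    (∀ v → Alternating (map (σ v) (select (A v)))) × (∀ {u v} → u ≢ v → σ u v ≢ σ v u)
  alternateRowsAntisymmetrically A
    with σ , rows , antisym ← twoMatchings (rowMatching (linePairing ∘ A)) swapMatching =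
    (λ v x → σ (v , x)) , rowMatching-alternating A (λ v x → σ (v , x)) rows ,
    (λ u≢v → antisym (swapMatching-partner u≢v))

-- Counting along selected entries.

sum-select : ∀ {n} (P : Fin n → Bool) (f : Fin n → ℕ) →
             List.sum (map f (select P)) ≡ sum (λ i → if P i then f i else 0)
sum-select {zero}  P f = refl
sum-select {suc n} P f with P zero
... | false = trans (cong List.sum (≡-sym (map-∘ (select (P ∘ suc))))) (sum-select (P ∘ suc) (f ∘ suc))
... | true  = cong (f zero +_)
  (trans (cong List.sum (≡-sym (map-∘ (select (P ∘ suc))))) (sum-select (P ∘ suc) (f ∘ suc)))

length-select : ∀ {n} (P : Fin n → Bool) → length (select P) ≡ sum (⟦_⟧ ∘ P)
length-select P = trans (length≡ (select P)) (sum-select P (λ _ → 1))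
  where
  length≡ : ∀ {A : Set} (l : List A) → length l ≡ List.sum (map (λ _ → 1) l)
  length≡ []      = refl
  length≡ (_ ∷ l) = cong suc (length≡ l)

∈-select : ∀ {n} (P : Fin n → Bool) {i} → P i ≡ true → i ∈ select P
∈-select P {zero} Pi rewrite Pi = here refl
∈-select P {suc i} Pi with P zero
... | false = ∈-map⁺ suc (∈-select (P ∘ suc) Pi)
... | true  = there (∈-map⁺ suc (∈-select (P ∘ suc) Pi))

-- Each pair contains exactly one `true`; the extra 1 pays for an unpaired last entry.
alternating-trues : ∀ bs → Alternating bs → length bs ≤ 1 + 2 * List.sum (map ⟦_⟧ bs)
alternating-trues []          _ = z≤n
alternating-trues (_ ∷ [])    _ = s≤s z≤n
alternating-trues (a ∷ b ∷ bs) (a≢b , alt) = begin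
  2 + length bs                                   ≤⟨ +-monoʳ-≤ 2 (alternating-trues bs alt) ⟩
  3 + 2 * t                                       ≡⟨ cong suc (*-distribˡ-+ 2 1 t) ⟨
  1 + 2 * (1 + t)                                 ≡⟨ cong (λ z → 1 + 2 * (z + t)) (one a b a≢b) ⟨
  1 + 2 * (⟦ a ⟧ + ⟦ b ⟧ + t)                     ≡⟨ cong (λ z → 1 + 2 * z) (+-assoc ⟦ a ⟧ ⟦ b ⟧ t) ⟩
  1 + 2 * (⟦ a ⟧ + (⟦ b ⟧ + t))                   ∎
  where
  open ≤-Reasoning
  t = List.sum (map ⟦_⟧ bs)
  one : ∀ a b → a ≢ b → ⟦ a ⟧ + ⟦ b ⟧ ≡ 1
  one false false a≢b = contradiction refl a≢b
  one false true  a≢b = refl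
  one true  false a≢b = refl
  one true  true  a≢b = contradiction refl a≢b

⟦∧⟧ : ∀ a b → (if a then ⟦ b ⟧ else 0) ≡ ⟦ a ∧ b ⟧
⟦∧⟧ false b = refl
⟦∧⟧ true  b = refl

alternating-half : ∀ {n} (P σ : Fin n → Bool) → Alternating (map σ (select P)) →
                   sum (⟦_⟧ ∘ P) ≤ 1 + 2 * sum (λ i → ⟦ P i ∧ σ i ⟧)
alternating-half P σ alt = begin
  sum (⟦_⟧ ∘ P)                                       ≡⟨ length-select P ⟨
  length (select P)                                   ≡⟨ length-map σ (select P) ⟨
  length (map σ (select P))                           ≤⟨ alternating-trues _ alt ⟩
  1 + 2 * List.sum (map ⟦_⟧ (map σ (select P)))       ≡⟨ cong (λ l → 1 + 2 * List.sum l) (map-∘ (select P)) ⟨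
  1 + 2 * List.sum (map (⟦_⟧ ∘ σ) (select P))         ≡⟨ cong (λ z → 1 + 2 * z) (sum-select P (⟦_⟧ ∘ σ)) ⟩
  1 + 2 * sum (λ i → if P i then ⟦ σ i ⟧ else 0)      ≡⟨ cong (λ z → 1 + 2 * z) (sum-cong-≗ (λ i → ⟦∧⟧ (P i) (σ i))) ⟩
  1 + 2 * sum (λ i → ⟦ P i ∧ σ i ⟧)                   ∎
  where open ≤-Reasoning

alternating-not : ∀ {A : Set} (σ : A → Bool) l → Alternating (map σ l) → Alternating (map (not ∘ σ) l)
alternating-not σ []          _           = tt
alternating-not σ (_ ∷ [])    _           = tt
alternating-not σ (a ∷ b ∷ l) (a≢b , alt) = a≢b ∘ not-injective , alternating-not σ l alt

before : ∀ {n} → (Fin n → ℕ) → Fin n → ℕ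
before f zero    = 0
before f (suc i) = f zero + before (f ∘ suc) i

before-cong : ∀ {n} {f g : Fin n → ℕ} v → (∀ u → u Fin.< v → f u ≡ g u) → before f v ≡ before g v
before-cong zero    f≗g = refl
before-cong (suc v) f≗g = cong₂ _+_ (f≗g zero (s≤s z≤n)) (before-cong v (λ u u<v → f≗g (suc u) (s≤s u<v)))

-- Window for the extra weight received

Window : ℕ → ℕ → Set
Window k c = ⌊ k /2⌋ ≤ c × c ≤ 2 + ⌊ k /2⌋

-- Reached after k marked entries containing c ones; bs are the marks still to come. An entry marked
-- true is free, one marked false follows the threshold rule `forced`.
data State (k c : ℕ) (bs : List Bool) : Set where
  even       : ∀ j → k ≡ j + j → c ≡ j ⊎ c ≡ suc j → Alternating bs → State k c bs
  odd-free   : ∀ j → k ≡ suc (j + j) → c ≡ j ⊎ c ≡ suc j ⊎ c ≡ 2 + j → Alternating (true ∷ bs) → State k c bs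
  odd-forced : ∀ j → k ≡ suc (j + j) → c ≡ suc j → Alternating (false ∷ bs) → State k c bs

⌊j+j/2⌋ : ∀ j → ⌊ j + j /2⌋ ≡ j
⌊j+j/2⌋ j = ≡-sym (n≡⌊n+n/2⌋ j)

⌊1+j+j/2⌋ : ∀ j → ⌊ suc (j + j) /2⌋ ≡ j
⌊1+j+j/2⌋ zero    = refl
⌊1+j+j/2⌋ (suc j) = trans (cong (λ z → suc ⌊ z /2⌋) (+-suc j j)) (cong suc (⌊1+j+j/2⌋ j))

-- The top value `2 + j` occurs only between a free entry and its forced partner, so the window also
-- holds when the last pair is incomplete.
state⇒window : ∀ {k c bs} → State k c bs → Window k c
state⇒window (even j refl (inj₁ refl) _) rewrite ⌊j+j/2⌋ j = ≤-refl , m≤n+m j 2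
state⇒window (even j refl (inj₂ refl) _) rewrite ⌊j+j/2⌋ j = n≤1+n j , n≤1+n (suc j)
state⇒window (odd-free j refl (inj₁ refl) _) rewrite ⌊1+j+j/2⌋ j = ≤-refl , m≤n+m j 2
state⇒window (odd-free j refl (inj₂ (inj₁ refl)) _) rewrite ⌊1+j+j/2⌋ j = n≤1+n j , n≤1+n (suc j)
state⇒window (odd-free j refl (inj₂ (inj₂ refl)) _) rewrite ⌊1+j+j/2⌋ j = m≤n+m j 2 , ≤-refl
state⇒window (odd-forced j refl refl _) rewrite ⌊1+j+j/2⌋ j = n≤1+n j , n≤1+n (suc j)

-- Contribute exactly when the ones so far are at most half of the entries so far.
forced : ℕ → ℕ → Bool
forced k c = does (c + c ≤? k)

forced-low : ∀ {k c} → c + c ≤ k → forced k c ≡ true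
forced-low {k} {c} le = dec-true (c + c ≤? k) le

forced-high : ∀ {k c} → k < c + c → forced k c ≡ false
forced-high {k} {c} lt = dec-false (c + c ≤? k) (<⇒≱ lt)

double-suc : ∀ j → suc j + suc j ≡ suc (suc (j + j))
double-suc j = cong suc (+-suc j j)

-- In each pair the forced entry absorbs the free one. If it comes second, it turns the counts `j`,
-- `1 + j`, `2 + j` into `1 + j`, `1 + j`, `2 + j`. If it comes first, it brings `j` or `1 + j` to
-- exactly `1 + j`, and the free entry adds at most one. Either way the pair ends in the even state
-- for `suc j`.
step : ∀ {k c} b (y : Bool) {bs} → State k c (b ∷ bs) → (b ≡ false → y ≡ forced k c) →
       State (k + 1) (c + ⟦ y ⟧) bs
step {k} {c} b y s rule rewrite +-comm k 1 | +-comm c ⟦ y ⟧ = go b y s rule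
  where
  go : ∀ {k c} b (y : Bool) {bs} → State k c (b ∷ bs) → (b ≡ false → y ≡ forced k c) →
       State (suc k) (⟦ y ⟧ + c) bs
  go true false (even j refl (inj₁ refl) alt) rule = odd-free j refl (inj₁ refl) alt
  go true false (even j refl (inj₂ refl) alt) rule = odd-free j refl (inj₂ (inj₁ refl)) alt
  go true true  (even j refl (inj₁ refl) alt) rule = odd-free j refl (inj₂ (inj₁ refl)) alt
  go true true  (even j refl (inj₂ refl) alt) rule = odd-free j refl (inj₂ (inj₂ refl)) alt
  go false y (even j refl (inj₁ refl) alt) rule
    rewrite trans (rule refl) (forced-low {j + j} {j} ≤-refl) = odd-forced j refl refl alt
  go false y (even j refl (inj₂ refl) alt) rule
    rewrite trans (rule refl) (forced-high {j + j} {suc j} (≤-trans (n≤1+n _) (≤-reflexive (≡-sym (double-suc j))))) =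
    odd-forced j refl refl alt
  go true  y (odd-free j refl c∈ (b≢b , alt)) rule = contradiction refl b≢b
  go false y (odd-free j refl (inj₁ refl) (_ , alt)) rule
    rewrite trans (rule refl) (forced-low {suc (j + j)} {j} (n≤1+n _)) =
    even (suc j) (≡-sym (double-suc j)) (inj₁ refl) alt
  go false y (odd-free j refl (inj₂ (inj₁ refl)) (_ , alt)) rule
    rewrite trans (rule refl) (forced-high {suc (j + j)} {suc j} (≤-reflexive (≡-sym (double-suc j)))) =
    even (suc j) (≡-sym (double-suc j)) (inj₁ refl) alt
  go false y (odd-free j refl (inj₂ (inj₂ refl)) (_ , alt)) rule
    rewrite trans (rule refl) (forced-high {suc (j + j)} {2 + j}
      (≤-trans (≤-reflexive (≡-sym (double-suc j))) (+-mono-≤ (n≤1+n (suc j)) (n≤1+n (suc j))))) =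
    even (suc j) (≡-sym (double-suc j)) (inj₂ refl) alt
  go false y     (odd-forced j refl refl (b≢b , alt)) rule = contradiction refl b≢b
  go true  false (odd-forced j refl refl (_ , alt)) rule = even (suc j) (≡-sym (double-suc j)) (inj₁ refl) alt
  go true  true  (odd-forced j refl refl (_ , alt)) rule = even (suc j) (≡-sym (double-suc j)) (inj₂ refl) alt

-- Stated for arbitrary counts `k` and `c` already reached, so that the induction can remove the
-- first entry.
scan : ∀ {n} (P σ y : Fin n → Bool) k c → State k c (map σ (select P)) →
       (∀ i → P i ≡ true → σ i ≡ false →
          y i ≡ forced (k + before (⟦_⟧ ∘ P) i) (c + before (λ u → ⟦ P u ∧ y u ⟧) i)) →
       Window (k + sum (⟦_⟧ ∘ P)) (c + sum (λ u → ⟦ P u ∧ y u ⟧))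
scan {zero} P σ y k c s rule rewrite +-identityʳ k | +-identityʳ c = state⇒window s
scan {suc n} P σ y k c s rule =
  subst₂ Window (+-assoc k _ _) (+-assoc c _ _)
    (scan (P ∘ suc) (σ ∘ suc) (y ∘ suc) (k + ⟦ P zero ⟧) (c + ⟦ P zero ∧ y zero ⟧)
      next (λ i Pi σi → trans (rule (suc i) Pi σi) (≡-sym (cong₂ forced (+-assoc k _ _) (+-assoc c _ _)))))
  where
  next : State (k + ⟦ P zero ⟧) (c + ⟦ P zero ∧ y zero ⟧) (map (σ ∘ suc) (select (P ∘ suc)))
  next with P zero in P0
  ... | false rewrite +-identityʳ k | +-identityʳ c = subst (State k c) (≡-sym (map-∘ (select (P ∘ suc)))) s
  ... | true  = subst (State (k + 1) (c + ⟦ y zero ⟧)) (≡-sym (map-∘ (select (P ∘ suc))))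
    (step (σ zero) (y zero) s (λ σ0 → trans (rule zero P0 σ0) (cong₂ forced (+-identityʳ k) (+-identityʳ c))))

scan-window : ∀ {n} (P σ y : Fin n → Bool) → Alternating (map σ (select P)) →
  (∀ i → P i ≡ true → σ i ≡ false → y i ≡ forced (before (⟦_⟧ ∘ P) i) (before (λ u → ⟦ P u ∧ y u ⟧) i)) →
  Window (sum (⟦_⟧ ∘ P)) (sum (λ u → ⟦ P u ∧ y u ⟧))
scan-window P σ y alt = scan P σ y 0 0 (even 0 refl (inj₁ refl) alt)

-- Greedy choice and fresh values in a residue class.

-- As `Good y v` depends only on the values up to `v`, later choices cannot spoil it. The start `y₀`
-- is a placeholder overwritten everywhere.
greedy : ∀ {n} {B : Set} (Good : (Fin n → B) → Fin n → Set) → (Fin n → B) →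
         (∀ {y y′} v → (∀ u → u Fin.≤ v → y u ≡ y′ u) → Good y v → Good y′ v) →
         (∀ y v → ∃ λ r → Good (updateAt y v (const r)) v) →
         ∃ λ y → ∀ v → Good y v
greedy {n} {B} Good y₀ local extend =
  let y , good = go n ≤-refl in y , λ v → good v (Fin.toℕ<n v)
  where
  go : ∀ k → k ≤ n → ∃ λ y → ∀ v → toℕ v < k → Good y v
  go zero    _   = y₀ , λ v ()
  go (suc k) k<n with go k (<⇒≤ k<n)
  ... | y , good = y′ , good′
    where
    v₀ = fromℕ< k<n
    r  = extend y v₀
    y′ = updateAt y v₀ (const (proj₁ r))
    good′ : ∀ v → toℕ v < suc k → Good y′ v
    good′ v v<1+k with v ≟ v₀
    ... | yes refl = proj₂ r
    ... | no v≢v₀  = local v (λ u u≤v → ≡-sym (updateAt-minimal u v₀ y (u≢v₀ u u≤v))) (good v v<k)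
      where
      v<k : toℕ v < k
      v<k = ≤∧≢⇒< (s≤s⁻¹ v<1+k) (λ eq → v≢v₀ (Fin.toℕ-injective (trans eq (≡-sym (Fin.toℕ-fromℕ< k<n)))))
      u≢v₀ : ∀ u → u Fin.≤ v → u ≢ v₀
      u≢v₀ u u≤v refl = <⇒≱ v<k (subst (_≤ toℕ v) (Fin.toℕ-fromℕ< k<n) u≤v)

subsetOfSize : ∀ {n} (P : Fin n → Bool) t → t ≤ sum (⟦_⟧ ∘ P) →
               ∃ λ (Q : Fin n → Bool) → sum (λ i → ⟦ P i ∧ Q i ⟧) ≡ t
subsetOfSize {zero}  P zero    _ = (λ ()) , refl
subsetOfSize {suc n} P t t≤ with P zero
... | false with Q , eq ← subsetOfSize (P ∘ suc) t t≤ = (λ { zero → false ; (suc i) → Q i }) , eq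
subsetOfSize {suc n} P zero t≤ | true with Q , eq ← subsetOfSize (P ∘ suc) zero z≤n =
  (λ { zero → false ; (suc i) → Q i }) , eq
subsetOfSize {suc n} P (suc t) t≤ | true with Q , eq ← subsetOfSize (P ∘ suc) t (s≤s⁻¹ t≤) =
  (λ { zero → true ; (suc i) → Q i }) , cong suc eq

freshValue : (f : ℕ → ℕ) → (∀ {i j} → f i ≡ f j → i ≡ j) → (bad : List ℕ) →
             ∃ λ i → i ≤ length bad × f i ∉ bad
freshValue f f-inj bad with Fin.any? {suc (length bad)} (λ i → ¬? (member? ℕ._≟_ (f (toℕ i)) bad))
-- There is one more candidate than bad values, so if all were bad, two would share a position in
-- `bad`.
... | yes (i , fi∉) = toℕ i , s≤s⁻¹ (Fin.toℕ<n i) , fi∉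
... | no none = contradiction (Fin.toℕ-injective {i = i} {j} (f-inj fi≡fj)) (Fin.<⇒≢ i<j)
  where
  f∈ : ∀ i → f (toℕ i) ∈ bad
  f∈ i = decidable-stable (member? ℕ._≟_ (f (toℕ i)) bad) (λ fi∉ → none (i , fi∉))
  collision = Fin.pigeonhole ≤-refl (λ i → index (f∈ i))
  i = proj₁ collision
  j = proj₁ (proj₂ collision)
  i<j = proj₁ (proj₂ (proj₂ collision))
  fi≡fj : f (toℕ i) ≡ f (toℕ j)
  fi≡fj = trans (lookup-index (f∈ i))
    (trans (cong (lookup bad) (proj₂ (proj₂ (proj₂ collision)))) (≡-sym (lookup-index (f∈ j))))

nextInClass : ∀ m a → a < m → ∀ b → ∃₂ λ q t → t < m × b + t ≡ a + q * m
nextInClass m a a<m zero = 0 , a , a<m , ≡-sym (+-identityʳ a)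
nextInClass m a a<m (suc b) with nextInClass m a a<m b
... | q , suc t , t<m , eq = q , t , <-trans (n<1+n t) t<m , trans (≡-sym (+-suc b t)) eq
-- Here `b` is itself in the class, so the next member lies a full period after it, at distance `m`
-- from `suc b`.
nextInClass (suc m) a a<m (suc b) | q , zero , t<m , eq = suc q , m , ≤-refl , (begin
  suc (b + m)              ≡⟨ +-suc b m ⟨
  b + suc m                ≡⟨ cong (_+ suc m) (trans (≡-sym (+-identityʳ b)) eq) ⟩
  a + q * suc m + suc m    ≡⟨ +-assoc a _ _ ⟩
  a + (q * suc m + suc m)  ≡⟨ cong (a +_) (+-comm (q * suc m) (suc m)) ⟩
  a + suc q * suc m        ∎)
  where open ≡-Reasoning

-- The first member of the class from `b` on, shifted by `0` to `length bad` periods, gives more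
-- candidates than bad values. All offsets are below `m * suc (length bad)`, hence at most `N`.
avoiding : ∀ m a → a < m → ∀ b N (bad : List ℕ) → m * suc (length bad) ≤ suc N →
           ∃₂ λ q t → t ≤ N × b + t ≡ a + q * m × b + t ∉ bad
avoiding m a a<m b N bad room = q + i , t + i * m , s≤s⁻¹ (≤-trans bound room) , value , proj₂ (proj₂ new)
  where
  instance
    m≢0 : NonZero m
    m≢0 = >-nonZero (≤-<-trans z≤n a<m)
  first = nextInClass m a a<m b
  q = proj₁ first
  t = proj₁ (proj₂ first)
  inj : ∀ {i j} → b + (t + i * m) ≡ b + (t + j * m) → i ≡ j
  inj {i} {j} eq = *-cancelʳ-≡ i j m (+-cancelˡ-≡ t _ _ (+-cancelˡ-≡ b _ _ eq))
  new = freshValue (λ i → b + (t + i * m)) inj bad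
  i = proj₁ new
  bound : t + i * m < m * suc (length bad)
  bound = begin-strict
    t + i * m               <⟨ +-mono-<-≤ (proj₁ (proj₂ (proj₂ first))) (*-monoˡ-≤ m (proj₁ (proj₂ new))) ⟩
    m + length bad * m      ≡⟨ *-comm (suc (length bad)) m ⟩
    m * suc (length bad)    ∎
    where open ≤-Reasoning
  value : b + (t + i * m) ≡ a + (q + i) * m
  value = begin
    b + (t + i * m)      ≡⟨ +-assoc b t _ ⟨
    b + t + i * m        ≡⟨ cong (_+ i * m) (proj₂ (proj₂ (proj₂ first))) ⟩
    a + q * m + i * m    ≡⟨ +-assoc a _ _ ⟩
    a + (q * m + i * m)  ≡⟨ cong (a +_) (*-distribʳ-+ m q i) ⟨
    a + (q + i) * m      ∎
    where open ≡-Reasoning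

-- Blocks of three consecutive numbers starting at multiples of 3 are disjoint.
thirds-injective : ∀ {k l s} → 3 * k ≤ s → s ≤ 2 + 3 * k → 3 * l ≤ s → s ≤ 2 + 3 * l → k ≡ l
thirds-injective {k} {l} k≤s s≤k l≤s s≤l = ≤-antisym (le k≤s s≤l) (le l≤s s≤k)
  where
  le : ∀ {k l s} → 3 * k ≤ s → s ≤ 2 + 3 * l → k ≤ l
  le {k} {l} k≤s s≤l = s≤s⁻¹ (*-cancelˡ-< 3 k (suc l) (begin-strict
    3 * k          ≤⟨ ≤-trans k≤s s≤l ⟩
    2 + 3 * l      <⟨ n<1+n _ ⟩
    3 + 3 * l      ≡⟨ *-suc 3 l ⟨
    3 * suc l      ∎))
    where open ≤-Reasoning

-- Weightings from owned edges

remainders-injective : ∀ {p} {a b : Fin p} q r → toℕ a + q * p ≡ toℕ b + r * p → a ≡ b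
remainders-injective {p} {a} {b} q r eq = Fin.toℕ-injective (begin
  toℕ a               ≡⟨ m<n⇒m%n≡m (Fin.toℕ<n a) ⟨
  toℕ a % p           ≡⟨ [m+kn]%n≡m%n (toℕ a) q p ⟨
  (toℕ a + q * p) % p ≡⟨ cong (_% p) eq ⟩
  (toℕ b + r * p) % p ≡⟨ [m+kn]%n≡m%n (toℕ b) r p ⟩
  toℕ b % p           ≡⟨ m<n⇒m%n≡m (Fin.toℕ<n b) ⟩
  toℕ b               ∎)
  where
  open ≡-Reasoning
  instance
    p≢0 : NonZero p
    p≢0 = Fin.nonZeroIndex a

-- `A v x` says that `v` owns the edge to `x`, and `σ` is `true` on the free owned edges. In
-- `A-large`, the factor 6 is 3 for the window length times 2 because only half of the owned edges
-- are free.
module _ {n p : ℕ} (F : Graph n) (φ : Fin n → Fin p) (A : Fin n → Fin n → Bool)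
         (A⊆F : ∀ {u v} → A u v ≡ true → adj F u v ≡ true)
         (A-antisym : ∀ {u v} → A u v ≡ true → A v u ≡ false)
         (A-large : ∀ v → 6 * p * suc (sum (λ u → ⟦ adj F v u ∧ sameType φ u v ⟧)) ≤ sum (⟦_⟧ ∘ A v))
         (σ : Fin n → Fin n → Bool)
         (σ-rows : ∀ v → Alternating (map (σ v) (select (A v))))
         (σ-columns : ∀ x → Alternating (map (λ v → σ v x) (select (λ v → A v x))))
         where

  private
    -- y u v ∈ {0, 1} is what the owner u of the edge uv adds to its weight.
    extra : (Fin n → Fin n → Bool) → Fin n → Fin n → ℕ
    extra y u v = ⟦ A u v ∧ y u v ⟧

    -- Weight 1 on every edge, plus the lower end of the window for what `v` receives.
    base : Fin n → ℕ
    base v = sum (⟦_⟧ ∘ adj F v) + ⌊ sum (λ u → ⟦ A u v ⟧) /2⌋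

    -- Depends on row v of y only, yet the weighted degree of v will exceed it by at most 2.
    floor : (Fin n → Fin n → Bool) → Fin n → ℕ
    floor y v = base v + sum (extra y v)

    -- What `v` must add to a forced edge towards `x`, given what `x` has received from owners
    -- before `v`.
    rule : (Fin n → Fin n → Bool) → Fin n → Fin n → Bool
    rule y v x = forced (before (λ u → ⟦ A u x ⟧) v) (before (λ u → extra y u x) v)

    -- By `residue` the window of `v` is a block of three whose index modulo `p` is the type of `v`.
    -- Different types thus never collide, and `distinct` need only treat neighbours of equal type,
    -- each pair at its later vertex.
    record Good (y : Fin n → Fin n → Bool) (v : Fin n) : Set where
      field
        follows  : ∀ x → A v x ≡ true → σ v x ≡ false → y v x ≡ rule y v x
        residue  : ∃ λ q → floor y v ≡ 3 * (toℕ (φ v) + q * p)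
        distinct : ∀ u → u Fin.< v → adj F v u ≡ true → φ u ≡ φ v → floor y v ≢ floor y u
    open Good

    rule-local : ∀ {y y′} v x → (∀ u → u Fin.< v → y u ≡ y′ u) → rule y v x ≡ rule y′ v x
    rule-local v x eq = cong (forced _) (before-cong v (λ u u<v → cong (λ row → ⟦ A u x ∧ row x ⟧) (eq u u<v)))

    floor-local : ∀ y y′ v → y v ≡ y′ v → floor y v ≡ floor y′ v
    floor-local y y′ v eq = cong (λ row → base v + sum (λ x → ⟦ A v x ∧ row x ⟧)) eq

    Good-local : ∀ {y y′} v → (∀ u → u Fin.≤ v → y u ≡ y′ u) → Good y v → Good y′ v
    Good-local {y} {y′} v eq good = record
      { follows  = λ x Avx σvx → trans (cong (λ row → row x) (≡-sym (eq v ≤-refl)))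
          (trans (follows good x Avx σvx) (rule-local v x (λ u u<v → eq u (<⇒≤ u<v))))
      ; residue  = proj₁ (residue good) , trans (≡-sym (floor-local y y′ v (eq v ≤-refl))) (proj₂ (residue good))
      ; distinct = λ u u<v vu φ≡ fl → distinct good u u<v vu φ≡
          (trans (floor-local y y′ v (eq v ≤-refl)) (trans fl (≡-sym (floor-local y y′ u (eq u (<⇒≤ u<v))))))
      }

    split : ∀ a s q r → ⟦ a ∧ (if s then q else r) ⟧ ≡ ⟦ a ∧ not s ∧ r ⟧ + ⟦ (a ∧ s) ∧ q ⟧
    split false s     q r = refl
    split true  false q r = ≡-sym (+-identityʳ _)
    split true  true  q r = refl

    module Extend (y : Fin n → Fin n → Bool) (v : Fin n) where
      free : Fin n → Bool
      free x = A v x ∧ σ v x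
      N = sum (⟦_⟧ ∘ free)
      -- The forced owned edges of `v` are determined by earlier rows; only the free ones remain to
      -- be chosen.
      fixed = sum (λ x → ⟦ A v x ∧ not (σ v x) ∧ rule y v x ⟧)
      rivals = select (λ u → adj F v u ∧ sameType φ u v)
      bad = map (floor y) rivals

      -- At least half of the owned edges are free up to rounding, which leaves a choice of modulus
      -- `3 * p` for each rival and one more.
      room : 3 * p * suc (length bad) ≤ suc N
      room = *-cancelˡ-≤ 2 (begin
        2 * (3 * p * suc (length bad))   ≡⟨ solve 2 (λ p l → con 2 :* (con 3 :* p :* l) := con 6 :* p :* l) refl p (suc (length bad)) ⟩
        6 * p * suc (length bad)         ≡⟨ cong (λ l → 6 * p * suc l) (trans (length-map (floor y) rivals) (length-select (λ u → adj F v u ∧ sameType φ u v))) ⟩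
        6 * p * suc (sum (λ u → ⟦ adj F v u ∧ sameType φ u v ⟧)) ≤⟨ A-large v ⟩
        sum (⟦_⟧ ∘ A v)                  ≤⟨ alternating-half (A v) (σ v) (σ-rows v) ⟩
        1 + 2 * N                        ≤⟨ n≤1+n _ ⟩
        2 + 2 * N                        ≡⟨ *-suc 2 N ⟨
        2 * suc N                        ∎)
        where open ≤-Reasoning

      module Row (q t : ℕ) (value : base v + fixed + t ≡ 3 * toℕ (φ v) + q * (3 * p))
                 (fresh : base v + fixed + t ∉ bad)
                 (Q : Fin n → Bool) (Q-size : sum (λ x → ⟦ free x ∧ Q x ⟧) ≡ t) where

        row : Fin n → Bool
        row x = if σ v x then Q x else rule y v x

        y′ = updateAt y v (const row)

        y′v : y′ v ≡ row
        y′v = updateAt-updates v y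

        earlier : ∀ u → u Fin.< v → y′ u ≡ y u
        earlier u u<v = updateAt-minimal u v y (Fin.<⇒≢ u<v)

        floor′ : floor y′ v ≡ base v + fixed + t
        floor′ = begin
          base v + sum (λ x → ⟦ A v x ∧ y′ v x ⟧)
            ≡⟨ cong (λ r → base v + sum (λ x → ⟦ A v x ∧ r x ⟧)) y′v ⟩
          base v + sum (λ x → ⟦ A v x ∧ row x ⟧)
            ≡⟨ cong (base v +_) (sum-cong-≗ (λ x → split (A v x) (σ v x) (Q x) (rule y v x))) ⟩
          base v + sum (λ x → ⟦ A v x ∧ not (σ v x) ∧ rule y v x ⟧ + ⟦ free x ∧ Q x ⟧)
            ≡⟨ cong (base v +_) (∑-distrib-+ (λ x → ⟦ A v x ∧ not (σ v x) ∧ rule y v x ⟧) (λ x → ⟦ free x ∧ Q x ⟧)) ⟩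
          base v + (fixed + sum (λ x → ⟦ free x ∧ Q x ⟧))
            ≡⟨ cong (λ z → base v + (fixed + z)) Q-size ⟩
          base v + (fixed + t)
            ≡⟨ +-assoc (base v) fixed t ⟨
          base v + fixed + t ∎
          where open ≡-Reasoning

        follows′ : ∀ x → A v x ≡ true → σ v x ≡ false → y′ v x ≡ rule y′ v x
        follows′ x _ σvx = begin
          y′ v x     ≡⟨ cong (λ r → r x) y′v ⟩
          row x      ≡⟨ cong (λ s → if s then Q x else rule y v x) σvx ⟩
          rule y v x ≡⟨ rule-local v x (λ u u<v → ≡-sym (earlier u u<v)) ⟩
          rule y′ v x ∎
          where open ≡-Reasoning

        residue′ : floor y′ v ≡ 3 * (toℕ (φ v) + q * p)
        residue′ = begin
          floor y′ v                      ≡⟨ floor′ ⟩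
          base v + fixed + t              ≡⟨ value ⟩
          3 * toℕ (φ v) + q * (3 * p)     ≡⟨ solve 3 (λ f q p → con 3 :* f :+ q :* (con 3 :* p) := con 3 :* (f :+ q :* p)) refl (toℕ (φ v)) q p ⟩
          3 * (toℕ (φ v) + q * p)         ∎
          where open ≡-Reasoning

        distinct′ : ∀ u → u Fin.< v → adj F v u ≡ true → φ u ≡ φ v → floor y′ v ≢ floor y′ u
        distinct′ u u<v vu φ≡ eq = fresh
          (subst (_∈ bad) (trans (≡-sym (floor-local y′ y u (earlier u u<v))) (trans (≡-sym eq) floor′))
            (∈-map⁺ (floor y) (∈-select (λ u → adj F v u ∧ sameType φ u v) (cong₂ _∧_ vu (sameType-refl φ φ≡)))))

        good-row : Good y′ v
        good-row = record { follows = follows′ ; residue = q , residue′ ; distinct = distinct′ }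

    Good-extend : ∀ y v → ∃ λ row → Good (updateAt y v (const row)) v
    Good-extend y v =
      let open Extend y v
          q , t , t≤N , value , fresh =
            avoiding (3 * p) (3 * toℕ (φ v)) (*-monoʳ-< 3 (Fin.toℕ<n (φ v))) (base v + fixed) N bad room
          Q , Q-size = subsetOfSize free t t≤N
          open Row q t value fresh Q Q-size
      in row , good-row

    module Solution (y : Fin n → Fin n → Bool) (good : ∀ v → Good y v) where

      weighting : Weighting12 F
      weighting = record
        { c     = λ u v → 1 + (extra y u v + extra y v u)
        ; c-sym = λ u v → cong suc (+-comm (extra y u v) (extra y v u))
        ; c-12  = λ u v _ → one-or-two u v
        }
        where
        one-or-two : ∀ u v → 1 + (extra y u v + extra y v u) ≡ 1 ⊎ 1 + (extra y u v + extra y v u) ≡ 2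
        one-or-two u v with A u v in Auv
        -- An edge has at most one owner, so at most one of the two extras is nonzero.
        one-or-two u v | true rewrite A-antisym Auv with y u v
        ... | false = inj₁ refl
        ... | true  = inj₂ refl
        one-or-two u v | false with A v u ∧ y v u
        ... | false = inj₁ refl
        ... | true  = inj₂ refl

      wdeg≡ : ∀ v → wdeg weighting v ≡
              sum (⟦_⟧ ∘ adj F v) + (sum (extra y v) + sum (λ u → extra y u v))
      wdeg≡ v = begin
        wdeg weighting v
          ≡⟨ sum-allFin (λ u → if adj F v u then 1 + (extra y v u + extra y u v) else 0) ⟩
        sum (λ u → if adj F v u then 1 + (extra y v u + extra y u v) else 0)
          ≡⟨ sum-cong-≗ term ⟩
        sum (λ u → ⟦ adj F v u ⟧ + (extra y v u + extra y u v))
          ≡⟨ ∑-distrib-+ (⟦_⟧ ∘ adj F v) (λ u → extra y v u + extra y u v) ⟩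
        sum (⟦_⟧ ∘ adj F v) + sum (λ u → extra y v u + extra y u v)
          ≡⟨ cong (sum (⟦_⟧ ∘ adj F v) +_) (∑-distrib-+ (extra y v) (λ u → extra y u v)) ⟩
        sum (⟦_⟧ ∘ adj F v) + (sum (extra y v) + sum (λ u → extra y u v)) ∎
        where
        open ≡-Reasoning
        not-owned : ∀ {u v} → adj F u v ≡ false → A u v ≡ false
        not-owned {u} {v} uv with A u v in Auv
        ... | false = refl
        ... | true  = trans (≡-sym (A⊆F Auv)) uv
        term : ∀ u → (if adj F v u then 1 + (extra y v u + extra y u v) else 0) ≡
                     ⟦ adj F v u ⟧ + (extra y v u + extra y u v)
        term u with adj F v u in vu
        ... | true  = refl
        ... | false rewrite not-owned vu | not-owned (trans (Graph.sym F u v) vu) = refl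

      window : ∀ v → floor y v ≤ wdeg weighting v × wdeg weighting v ≤ 2 + floor y v
      window v = subst (floor y v ≤_) (≡-sym (wdeg≡ v)) lower , subst (_≤ 2 + floor y v) (≡-sym (wdeg≡ v)) upper
        where
        d = sum (⟦_⟧ ∘ adj F v)
        out = sum (extra y v)
        inn = sum (λ u → extra y u v)
        h = ⌊ sum (λ u → ⟦ A u v ⟧) /2⌋
        win : h ≤ inn × inn ≤ 2 + h
        -- Column `v` lists the owners of edges received by `v` in processing order; `follows`
        -- supplies the forced entries.
        win = scan-window (λ u → A u v) (λ u → σ u v) (λ u → y u v) (σ-columns v)
                (λ u Auv σuv → follows (good u) v Auv σuv)
        open ≤-Reasoning
        lower : floor y v ≤ d + (out + inn)
        lower = begin
          d + h + out     ≡⟨ +-assoc d h out ⟩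
          d + (h + out)   ≡⟨ cong (d +_) (+-comm h out) ⟩
          d + (out + h)   ≤⟨ +-monoʳ-≤ d (+-monoʳ-≤ out (proj₁ win)) ⟩
          d + (out + inn) ∎
        upper : d + (out + inn) ≤ 2 + floor y v
        upper = begin
          d + (out + inn)     ≤⟨ +-monoʳ-≤ d (+-monoʳ-≤ out (proj₂ win)) ⟩
          d + (out + (2 + h)) ≡⟨ solve 3 (λ d o h → d :+ (o :+ (con 2 :+ h)) := con 2 :+ (d :+ h :+ o)) refl d out h ⟩
          2 + (d + h + out)   ∎

      -- Equal weighted degrees lie in the same block of three, which forces equal types and equal
      -- floors, against `distinct` at the later endpoint.
      proper : ∀ u v → adj F u v ≡ true → wdeg weighting u ≢ wdeg weighting v
      proper u v uv eq = impossible (Fin.<-cmp u v)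
        where
        qu = residue (good u)
        qv = residue (good v)
        κ≡ : toℕ (φ u) + proj₁ qu * p ≡ toℕ (φ v) + proj₁ qv * p
        κ≡ = thirds-injective
          (subst (_≤ wdeg weighting u) (proj₂ qu) (proj₁ (window u)))
          (subst (λ z → wdeg weighting u ≤ 2 + z) (proj₂ qu) (proj₂ (window u)))
          (subst₂ _≤_ (proj₂ qv) (≡-sym eq) (proj₁ (window v)))
          (subst₂ (λ s z → s ≤ 2 + z) (≡-sym eq) (proj₂ qv) (proj₂ (window v)))
        φ≡ : φ u ≡ φ v
        φ≡ = remainders-injective (proj₁ qu) (proj₁ qv) κ≡
        floor≡ : floor y u ≡ floor y v
        floor≡ = trans (proj₂ qu) (trans (cong (3 *_) κ≡) (≡-sym (proj₂ qv)))
        impossible : Tri (u Fin.< v) (u ≡ v) (v Fin.< u) → _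
        impossible (tri< u<v _ _) = distinct (good v) u u<v (trans (Graph.sym F v u) uv) φ≡ (≡-sym floor≡)
        impossible (tri≈ _ refl _) with () ← trans (≡-sym uv) (Graph.irref F u)
        impossible (tri> _ _ v<u) = distinct (good u) v v<u uv (≡-sym φ≡) floor≡

  markedEdges⇒colourable : WeightColourable12 F
  markedEdges⇒colourable =
    let y , good = greedy Good (λ _ _ → false) Good-local Good-extend
        open Solution y good
    in weighting , proper

-- Alternation in rows leaves every owner enough free edges; alternation in columns keeps every
-- received weight in its window.
ownedEdges⇒colourable : ∀ {n p} (F : Graph n) (φ : Fin n → Fin p) (A : Fin n → Fin n → Bool) →
  (∀ {u v} → A u v ≡ true → adj F u v ≡ true) →
  (∀ {u v} → A u v ≡ true → A v u ≡ false) →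
  (∀ v → 6 * p * suc (sum (λ u → ⟦ adj F v u ∧ sameType φ u v ⟧)) ≤ sum (⟦_⟧ ∘ A v)) →
  WeightColourable12 F
ownedEdges⇒colourable F φ A A⊆F A-antisym A-large =
  let σ , rows , columns = alternateRowsAndColumns A
  in markedEdges⇒colourable F φ A A⊆F A-antisym A-large σ rows columns

-- The decomposition

Decomposition : ∀ {n} → Graph n → Set
Decomposition {n} G = Σ (Fin n → Fin n → Bool) λ m → Σ (∀ u v → m u v ≡ m v u) λ msym →
  WeightColourable12 (restrict G m msym)
    × WeightColourable12 (restrict G (notMask m) (notMask-sym m msym))

module _ {n p : ℕ} (G : Graph n) where

  deg : Fin n → ℕ
  deg v = sum (⟦_⟧ ∘ adj G v)

  clash : (Fin n → Fin p) → Fin n → ℕ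
  clash φ v = sum (λ u → ⟦ adj G v u ∧ sameType φ u v ⟧)

  clash₂ : (Fin n → Fin p) → (Fin n → Fin p) → Fin n → ℕ
  clash₂ φ₁ φ₂ v = sum (λ u → ⟦ adj G v u ∧ (sameType φ₁ u v ∧ sameType φ₂ u v) ⟧)

  firstTypes : (Fin n → Fin p) → ∃ λ φ → ∀ v → p * clash φ v ≤ deg v
  firstTypes φ₀ with φ , cut ← maxCut p (λ u v → ⟦ adj G u v ⟧)
      (λ u v → cong ⟦_⟧ (Graph.sym G u v)) (λ v → cong ⟦_⟧ (Graph.irref G v)) φ₀ =
    φ , λ v → subst (λ z → p * z ≤ deg v) (sum-cong-≗ (λ u → product (adj G v u) (sameType φ u v))) (cut v)
    where
    product : ∀ a b → ⟦ a ⟧ * ⟦ b ⟧ ≡ ⟦ a ∧ b ⟧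
    product false b = refl
    product true  b = +-identityʳ ⟦ b ⟧

  -- Edges inside a class of φ₁ weigh p + 1 instead of 1, so that φ₂ cuts them as well.
  secondTypes : ∀ φ₁ → (Fin n → Fin p) →
    ∃ λ φ₂ → ∀ v → p * (clash φ₂ v + p * clash₂ φ₁ φ₂ v) ≤ deg v + p * clash φ₁ v
  secondTypes φ₁ φ₀ = φ₂ , λ v → subst₂ (λ x y → p * x ≤ y) (left v) (right v) (proj₂ cut v)
    where
    w : Fin n → Fin n → ℕ
    w v u = ⟦ adj G v u ⟧ + p * ⟦ adj G v u ∧ sameType φ₁ u v ⟧
    cut = maxCut p w
      (λ u v → cong₂ (λ a s → ⟦ a ⟧ + p * ⟦ a ∧ s ⟧) (Graph.sym G u v) (sameType-sym φ₁ v u))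
      (λ v → trans (cong (λ a → ⟦ a ⟧ + p * ⟦ a ∧ sameType φ₁ v v ⟧) (Graph.irref G v)) (*-zeroʳ p)) φ₀
    φ₂ = proj₁ cut
    spread : ∀ (f g : Fin n → ℕ) → sum (λ u → f u + p * g u) ≡ sum f + p * sum g
    spread f g = trans (∑-distrib-+ f (λ u → p * g u)) (cong (sum f +_) (≡-sym (*-distribˡ-sum p g)))
    right : ∀ v → sum (w v) ≡ deg v + p * clash φ₁ v
    right v = spread (⟦_⟧ ∘ adj G v) (λ u → ⟦ adj G v u ∧ sameType φ₁ u v ⟧)
    term : ∀ a s t → (⟦ a ⟧ + p * ⟦ a ∧ s ⟧) * ⟦ t ⟧ ≡ ⟦ a ∧ t ⟧ + p * ⟦ a ∧ (s ∧ t) ⟧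
    term false s     t     = trans (cong (_* ⟦ t ⟧) (*-zeroʳ p)) (≡-sym (*-zeroʳ p))
    term true  false false = trans (*-zeroʳ (1 + p * 0)) (≡-sym (*-zeroʳ p))
    term true  true  false = trans (*-zeroʳ (1 + p * 1)) (≡-sym (*-zeroʳ p))
    term true  false true  = *-identityʳ (1 + p * 0)
    term true  true  true  = *-identityʳ (1 + p * 1)
    left : ∀ v → sum (λ u → w v u * ⟦ sameType φ₂ u v ⟧) ≡ clash φ₂ v + p * clash₂ φ₁ φ₂ v
    left v = trans (sum-cong-≗ (λ u → term (adj G v u) (sameType φ₁ u v) (sameType φ₂ u v)))
      (spread (λ u → ⟦ adj G v u ∧ sameType φ₂ u v ⟧) (λ u → ⟦ adj G v u ∧ (sameType φ₁ u v ∧ sameType φ₂ u v) ⟧))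

  module Split (φ₁ φ₂ : Fin n → Fin p)
    (slack : ∀ v → 24 * p * suc (clash₂ φ₁ φ₂ v) + 3 + (clash φ₁ v + clash φ₂ v) ≤ deg v)
    where

    E : Fin n → Fin n → Bool
    E v u = adj G v u ∧ (not (sameType φ₁ u v) ∧ not (sameType φ₂ u v))

    module Oriented
      (σ : Fin n → Fin n → Bool)
      (σ-rows : ∀ v → Alternating (map (σ v) (select (E v))))
      (σ-antisym : ∀ {u v} → u ≢ v → σ u v ≢ σ v u) where

      A : Fin n → Fin n → Bool
      A v u = E v u ∧ σ v u

      module Halved
        (ς : Fin n → Fin n → Bool)
        (ς-rows : ∀ v → Alternating (map (ς v) (select (A v)))) where

        A₁ A₂ : Fin n → Fin n → Bool
        A₁ v u = A v u ∧ ς v u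
        A₂ v u = A v u ∧ not (ς v u)

        -- `true` means `G₁`. An edge whose ends differ in both types goes where its owner's mark
        -- `ς` sends it; the disjunction tries both ends as owner.
        m : Fin n → Fin n → Bool
        m v u = sameType φ₂ u v ∨ (not (sameType φ₁ u v) ∧ (A₁ v u ∨ A₁ u v))

        m-sym : ∀ u v → m u v ≡ m v u
        m-sym u v = cong₂ _∨_ (sameType-sym φ₂ v u)
          (cong₂ (λ s z → not s ∧ z) (sameType-sym φ₁ v u) (∨-comm (A₁ u v) (A₁ v u)))

        A-antisym : ∀ {u v} → A u v ≡ true → A v u ≡ false
        A-antisym {u} {v} Auv = second Auv (λ { refl → loop Auv }) (E v u) (σ v u) refl
          where
          loop : A u u ≢ true
          loop eq rewrite Graph.irref G u with () ← eq
          second : A u v ≡ true → u ≢ v → ∀ e s → s ≡ σ v u → e ∧ s ≡ false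
          second _ _ false s _ = refl
          second _ _ true false _ = refl
          second eq u≢v true true s with E u v
          ... | true = contradiction (trans eq s) (σ-antisym u≢v)

        -- At most `clash φ₁ v + clash φ₂ v` edges at `v` lie outside `E`. Two halvings, by
        -- orientation and by `ς`, turn the factor 24 into 6 and lose 3 to rounding.
        enough : ∀ (B : Fin n → Fin n → Bool) → (∀ v → sum (⟦_⟧ ∘ A v) ≤ 1 + 2 * sum (⟦_⟧ ∘ B v)) →
                 ∀ v {c} → c ≤ clash₂ φ₁ φ₂ v → 6 * p * suc c ≤ sum (⟦_⟧ ∘ B v)
        enough B half v {c} c≤ = *-cancelˡ-≤ 4 (+-cancelʳ-≤ 3 _ _ (+-cancelʳ-≤ (a + b) _ _ (begin
          4 * (6 * p * suc c) + 3 + (a + b)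
            ≡⟨ cong (λ z → z + 3 + (a + b)) (trans (≡-sym (*-assoc 4 (6 * p) (suc c))) (cong (_* suc c) (≡-sym (*-assoc 4 6 p)))) ⟩
          24 * p * suc c + 3 + (a + b)
            ≤⟨ +-monoˡ-≤ (a + b) (+-monoˡ-≤ 3 (*-monoʳ-≤ (24 * p) (s≤s c≤))) ⟩
          24 * p * suc (clash₂ φ₁ φ₂ v) + 3 + (a + b)
            ≤⟨ slack v ⟩
          deg v
            ≤⟨ cover ⟩
          sum (⟦_⟧ ∘ E v) + (a + b)
            ≤⟨ +-monoˡ-≤ (a + b) (alternating-half (E v) (σ v) (σ-rows v)) ⟩
          1 + 2 * sum (⟦_⟧ ∘ A v) + (a + b)
            ≤⟨ +-monoˡ-≤ (a + b) (+-monoʳ-≤ 1 (*-monoʳ-≤ 2 (half v))) ⟩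
          1 + 2 * (1 + 2 * k) + (a + b)
            ≡⟨ cong (_+ (a + b)) (solve 1 (λ k → con 1 :+ con 2 :* (con 1 :+ con 2 :* k) := con 4 :* k :+ con 3) refl k) ⟩
          4 * k + 3 + (a + b) ∎)))
          where
          open ≤-Reasoning
          a = clash φ₁ v
          b = clash φ₂ v
          k = sum (⟦_⟧ ∘ B v)
          term : ∀ x s t → ⟦ x ⟧ ≤ ⟦ x ∧ (not s ∧ not t) ⟧ + (⟦ x ∧ s ⟧ + ⟦ x ∧ t ⟧)
          term false s     t     = z≤n
          term true  false false = s≤s z≤n
          term true  false true  = s≤s z≤n
          term true  true  t     = s≤s z≤n
          cover : deg v ≤ sum (⟦_⟧ ∘ E v) + (a + b)
          cover = begin
            deg v
              ≤⟨ sum-mono-≤ (λ u → term (adj G v u) (sameType φ₁ u v) (sameType φ₂ u v)) ⟩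
            sum (λ u → ⟦ E v u ⟧ + (⟦ adj G v u ∧ sameType φ₁ u v ⟧ + ⟦ adj G v u ∧ sameType φ₂ u v ⟧))
              ≡⟨ ∑-distrib-+ (⟦_⟧ ∘ E v) (λ u → ⟦ adj G v u ∧ sameType φ₁ u v ⟧ + ⟦ adj G v u ∧ sameType φ₂ u v ⟧) ⟩
            sum (⟦_⟧ ∘ E v) + sum (λ u → ⟦ adj G v u ∧ sameType φ₁ u v ⟧ + ⟦ adj G v u ∧ sameType φ₂ u v ⟧)
              ≡⟨ cong (sum (⟦_⟧ ∘ E v) +_) (∑-distrib-+ (λ u → ⟦ adj G v u ∧ sameType φ₁ u v ⟧) (λ u → ⟦ adj G v u ∧ sameType φ₂ u v ⟧)) ⟩
            sum (⟦_⟧ ∘ E v) + (a + b) ∎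

        half₁ : ∀ v → sum (⟦_⟧ ∘ A v) ≤ 1 + 2 * sum (⟦_⟧ ∘ A₁ v)
        half₁ v = alternating-half (A v) (ς v) (ς-rows v)

        half₂ : ∀ v → sum (⟦_⟧ ∘ A v) ≤ 1 + 2 * sum (⟦_⟧ ∘ A₂ v)
        half₂ v = alternating-half (A v) (not ∘ ς v) (alternating-not (ς v) (select (A v)) (ς-rows v))

        G₁ G₂ : Graph n
        G₁ = restrict G m m-sym
        G₂ = restrict G (notMask m) (notMask-sym m m-sym)

        -- An edge inside a `φ₁`-class enters `G₁` only by sharing its `φ₂`-type as well.
        inner₁ : ∀ v → sum (λ u → ⟦ adj G₁ v u ∧ sameType φ₁ u v ⟧) ≤ clash₂ φ₁ φ₂ v
        inner₁ v = sum-mono-≤ (λ u → term (adj G v u) (sameType φ₁ u v) (sameType φ₂ u v) (A₁ v u ∨ A₁ u v))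
          where
          term : ∀ x s t z → ⟦ (x ∧ (t ∨ (not s ∧ z))) ∧ s ⟧ ≤ ⟦ x ∧ (s ∧ t) ⟧
          term false s     t     z     = z≤n
          term true  true  true  z     = s≤s z≤n
          term true  true  false z     = z≤n
          term true  false true  z     = z≤n
          term true  false false false = z≤n
          term true  false false true  = z≤n

        -- All edges inside `φ₂`-classes went to `G₁`, so the count is 0.
        inner₂ : ∀ v → sum (λ u → ⟦ adj G₂ v u ∧ sameType φ₂ u v ⟧) ≤ clash₂ φ₁ φ₂ v
        inner₂ v = ≤-trans (≤-reflexive (sum-zero _ (λ u → term (adj G v u) (sameType φ₂ u v) _))) z≤n
          where
          term : ∀ x t z → ⟦ (x ∧ not (t ∨ z)) ∧ t ⟧ ≡ 0
          term false t     z     = refl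
          term true  true  z     = refl
          term true  false false = refl
          term true  false true  = refl

        A₁⊆G₁ : ∀ {v u} → A₁ v u ≡ true → adj G₁ v u ≡ true
        A₁⊆G₁ {v} {u} A₁vu = go (adj G v u) (sameType φ₁ u v) (sameType φ₂ u v) (σ v u) (ς v u) (A₁ u v) A₁vu
          where
          go : ∀ x s t o h z → ((x ∧ (not s ∧ not t)) ∧ o) ∧ h ≡ true →
               x ∧ (t ∨ (not s ∧ ((((x ∧ (not s ∧ not t)) ∧ o) ∧ h) ∨ z))) ≡ true
          go true false false true true z _ = refl

        A₂⊆G₂ : ∀ {v u} → A₂ v u ≡ true → adj G₂ v u ≡ true
        A₂⊆G₂ {v} {u} A₂vu = go (adj G v u) (sameType φ₁ u v) (sameType φ₂ u v) (σ v u) (ς v u) (A₁ u v) unowned A₂vu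
          where
          -- The edge is owned by `v`, so `u` cannot claim it for `G₁`.
          unowned : A₁ u v ≡ false
          unowned = cong (_∧ ς u v) (A-antisym (∧-conicalˡ (A v u) _ A₂vu))
          go : ∀ x s t o h z → z ≡ false → ((x ∧ (not s ∧ not t)) ∧ o) ∧ not h ≡ true →
               x ∧ not (t ∨ (not s ∧ ((((x ∧ (not s ∧ not t)) ∧ o) ∧ h) ∨ z))) ≡ true
          go true false false true false z refl _ = refl

        A₁-antisym : ∀ {u v} → A₁ u v ≡ true → A₁ v u ≡ false
        A₁-antisym {u} {v} A₁uv = cong (_∧ ς v u) (A-antisym (∧-conicalˡ (A u v) _ A₁uv))

        A₂-antisym : ∀ {u v} → A₂ u v ≡ true → A₂ v u ≡ false
        A₂-antisym {u} {v} A₂uv = cong (_∧ not (ς v u)) (A-antisym (∧-conicalˡ (A u v) _ A₂uv))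

        decomposition : Decomposition G
        decomposition = m , m-sym
          , ownedEdges⇒colourable G₁ φ₁ A₁ A₁⊆G₁ A₁-antisym (λ v → enough A₁ half₁ v (inner₁ v))
          , ownedEdges⇒colourable G₂ φ₂ A₂ A₂⊆G₂ A₂-antisym (λ v → enough A₂ half₂ v (inner₂ v))

    decomposition : Decomposition G
    decomposition =
      let σ , σ-rows , σ-antisym = alternateRowsAntisymmetrically E
          ς , ς-rows , _ = alternateRowsAndColumns (Oriented.A σ σ-rows σ-antisym)
      in Oriented.Halved.decomposition σ σ-rows σ-antisym ς ς-rows

-- Choice of the constants.

-- After multiplication by `p`, the constant terms and `p * a` cost `d` each. Raising `p * b` to
-- `24 * (p * b)` lets the second cut bound the rest by 24 times `2 * d`, for a total of `50 * d`.
slackArithmetic : ∀ p d a b c → 50 ≤ p → 24 * (p * p) + 3 * p ≤ d →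
  p * a ≤ d → p * (b + p * c) ≤ d + p * a → 24 * p * suc c + 3 + (a + b) ≤ d
slackArithmetic p d a b c 50≤p p²≤d pa≤d pb≤ = *-cancelˡ-≤ p (begin
  p * (24 * p * suc c + 3 + (a + b))
    ≡⟨ solve 4 (λ p a b c → p :* (con 24 :* p :* (con 1 :+ c) :+ con 3 :+ (a :+ b))
         := (con 24 :* (p :* p) :+ con 3 :* p) :+ (p :* a :+ (p :* b :+ con 24 :* (p :* (p :* c))))) refl p a b c ⟩
  (24 * (p * p) + 3 * p) + (p * a + (p * b + 24 * (p * (p * c))))
    ≤⟨ +-mono-≤ p²≤d (+-mono-≤ pa≤d (+-monoˡ-≤ (24 * (p * (p * c))) (m≤n*m (p * b) 24))) ⟩
  d + (d + (24 * (p * b) + 24 * (p * (p * c))))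
    ≡⟨ solve 4 (λ d p b c → d :+ (d :+ (con 24 :* (p :* b) :+ con 24 :* (p :* (p :* c))))
         := d :+ (d :+ con 24 :* (p :* (b :+ p :* c)))) refl d p b c ⟩
  d + (d + 24 * (p * (b + p * c)))
    ≤⟨ +-monoʳ-≤ d (+-monoʳ-≤ d (*-monoʳ-≤ 24 (≤-trans pb≤ (+-monoʳ-≤ d pa≤d)))) ⟩
  d + (d + 24 * (d + d))
    ≡⟨ solve 1 (λ d → d :+ (d :+ con 24 :* (d :+ d)) := con 50 :* d) refl d ⟩
  50 * d
    ≤⟨ *-monoˡ-≤ d 50≤p ⟩
  p * d ∎)
  where
  open ≤-Reasoning
  instance
    p≢0 : NonZero p
    p≢0 = >-nonZero (≤-trans (s≤s z≤n) 50≤p)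

decompose : ∀ {n} p (G : Graph n) → (Fin n → Fin p) → 50 ≤ p →
            (∀ v → 24 * (p * p) + 3 * p ≤ degree G v) → Decomposition G
decompose p G φ₀ 50≤p large =
  let φ₁ , cut₁ = firstTypes G φ₀
      φ₂ , cut₂ = secondTypes G φ₁ φ₀
  in Split.decomposition G φ₁ φ₂ (λ v → slackArithmetic p (deg {p = p} G v) (clash G φ₁ v) (clash G φ₂ v) (clash₂ G φ₁ φ₂ v) 50≤p
       (subst (_ ≤_) (sum-allFin (⟦_⟧ ∘ adj G v)) (large v)) (cut₁ v) (cut₂ v))

theorem3 : (n : ℕ) (G : Graph n) → minDegree≥ G (10 ^ 6) →
    Σ (Fin n → Fin n → Bool) λ m → Σ (∀ u v → m u v ≡ m v u) λ msym →
      WeightColourable12 (restrict G m msym)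
        × WeightColourable12 (restrict G (notMask m) (notMask-sym m msym))
-- With 100 types the required degree is 240300, below the assumed bound. The constant assignment
-- only starts the local searches.
theorem3 n G large = decompose 100 G (λ _ → zero) (≤ᵇ⇒≤ 50 100 tt)
  (λ v → ≤-trans (≤ᵇ⇒≤ (24 * (100 * 100) + 3 * 100) (10 ^ 6) tt) (large v))
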